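{- Let $\mathcal{P}$ be a logic program with negations, with domain $D_{\mathcal P}$, let $\Omega$ be a ground atom, and let $\varphi=\psi_1\to\cdots\to\psi_d\to \mathit{loop}$ be the formula of first-order minimal logic constructed from $\mathcal{P}$ and $\Omega$ as described in the context, where $\psi_1,\ldots,\psi_d$ are all the axioms (1)–(13) listed there. Then $\varphi$ is intuitionistically provable if and only if $\mathcal{P}$ entails $\Omega$ under stable model semantics, i.e. every stable model of $\mathcal{P}$ contains $\Omega$.
   Context: **Programs.** A positive atom is $\mathrm P(\vec x)$ where $\vec x$ consists of individual variables or constants; a negative atom is $\neg \mathrm P(\vec x)$. A ground atom contains only constants. A clause is an expression $\mathbf a \mathrel{:- } \mathbf a_1,\ldots,\mathbf a_n$ with $\mathbf a$ a positive atom and each $\mathbf a_i$ a positive or negative atom; $\mathbf a$ is its target, and $\mathbf a_1,\ldots,\mathbf a_n$ its right-hand side (rhs). A program $\mathcal P$ is a finite set of clauses together with a nonempty finite set of constants $D_{\mathcal P}$ (its domain) containing all constants occurring in $\mathcal P$. $B(\mathcal P)$ is the set of all positive ground atoms built from predicates of $\mathcal P$ and constants of $D_{\mathcal P}$. $\mathit{ground}(\mathcal P)$ is the set of all ground instances of clauses of $\mathcal P$ over $D_{\mathcal P}$. A model is a set $\mathfrak M$ of positive ground atoms over the language of $\mathcal P$ and $D_{\mathcal P}$. The program $\mathcal P^{\mathfrak M}$ is obtained from $\mathit{ground}(\mathcal P)$ by doing the following for every ground atom $\mathbf a$: if $\mathbf a\notin\mathfrak M$, delete $\neg\mathbf a$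 from the rhs of all clauses; if $\mathbf a\in\mathfrak M$, delete all clauses with $\neg\mathbf a$ at the rhs. $I(\mathcal P,\mathfrak M)$ is the least fixed point of $F(\mathcal I)=\mathcal I\cup\{\mathbf a \mid \text{there is a clause } \mathbf a\mathrel{:- }\mathbf a_1,\ldots,\mathbf a_n \text{ in } \mathcal P^{\mathfrak M} \text{ with all } \mathbf a_i\in\mathcal I\}$. $\mathfrak M$ is stable if $\mathfrak M=I(\mathcal P,\mathfrak M)$. **Logic.** Formulas are those of first-order minimal predicate logic with only $\to$ (associating to the right) and $\forall$, without function symbols or equality. Intuitionistic provability $\vdash$ is natural deduction with the introduction and elimination rules for $\to$ and $\forall$; the constants of $D_{\mathcal P}$ are treated as free object variables. **Notation for clauses.** Let $D_{\mathcal P}=\{c_1,\ldots,c_m\}$. Each clause $K$ of $\mathcal P$ is written $\mathrm R(\vec u)\mathrel{:- }\mathrm P_1(\vec v_1),\ldots,\mathrm P_r(\vec v_r),\neg \mathrm S_1(\vec w_1),\ldots,\neg \mathrm S_s(\vec w_s)$, where $\vec u,\vec v_i,\vec w_j$ are vectors of variables and constants, possibly with repetitions. $\vec x$ is the sequence of all variables in $\vec u$ without repetitions, $\vec y$ is the sequence of all variables occurring at the rhs but not in $\vec x$, without repetitions; we write $K=K(\vec x,\vec y)$. The target predicate of $K$ is $\mathrm R$. **Vocabulary of $\varphi$.** For every predicate $\mathrm P$ of $\mathcal P$: four predicates $\mathrm P,\overline{\mathrm P},\mathrm P!,\mathrm P?$ of the same arity. For all predicates $\mathrm P,\mathrm Q$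 of $\mathcal P$: a predicate $\mathrm{PQ}$ whose arity is the sum of arities of $\mathrm P$ and $\mathrm Q$. For every clause $K(\vec x,\vec y)$ with target predicate of arity $l$ and every $i=0,\ldots,|\vec y|$: a predicate $\mathrm K^i$ of arity $l+i$ and a nullary predicate $\overline{\mathrm K}^i$. Nullary predicates $\mathit{loop},\mathrm A,\mathrm B,\circ,\bullet$, and the atom $\Omega$. All these auxiliary symbols are distinct and new. **Axioms** (vectors $\vec z,\vec z_i$ consist of distinct variables): (1) $\forall\vec z((\mathrm R(\vec z)\to\mathit{loop})\to(\overline{\mathrm R}(\vec z)\to\mathit{loop})\to\mathit{loop})$, for every predicate $\mathrm R$ of $\mathcal P$. (2) $\Omega\to\mathit{loop}$, $\ \mathrm A\to\mathit{loop}$, $\ \mathrm B\to\mathit{loop}$. (3) $\forall\vec z(\overline{\mathrm R}(\vec z)\to(\mathrm R!(\vec z)\to\bullet)\to\mathrm A)$, for every predicate $\mathrm R$ of $\mathcal P$. (4) $\forall\vec z(\mathrm R(\vec z)\to(\mathrm R?(\vec z)\to\circ)\to\mathrm B)$, for every predicate $\mathrm R$ of $\mathcal P$. (5) $\forall\vec x\vec y(\mathrm R!(\vec u)\to(\mathrm P_1!(\vec v_1)\to\bullet)\to\cdots\to(\mathrm P_r!(\vec v_r)\to\bullet)\to\overline{\mathrm S}_1(\vec w_1)\to\cdots\to\overline{\mathrm S}_s(\vec w_s)\to\bullet)$, for every clause $K(\vec x,\vec y)$ of $\mathcal P$ of the form $\mathrm R(\vec u)\mathrel{:- }\mathrm P_1(\vec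 v_1),\ldots,\mathrm P_r(\vec v_r),\neg \mathrm S_1(\vec w_1),\ldots,\neg \mathrm S_s(\vec w_s)$. (6) $\forall\vec z(\mathrm R?(\vec z)\to(\mathrm K_1^0(\vec z)\to\overline{\mathrm K}{}_1^0)\to\cdots\to(\mathrm K_l^0(\vec z)\to\overline{\mathrm K}{}_l^0)\to\circ)$, for every predicate $\mathrm R$ of $\mathcal P$, where $K_1,\ldots,K_l$ are all clauses with target predicate $\mathrm R$. (7) $\forall\vec z_1\vec z_2(\mathrm K^0(\vec z_1,d,\vec z_2)\to\overline{\mathrm K}{}^0)$, for every clause $K$ with target $\mathrm R(\vec u)$ in which a constant $c$ is the $(|\vec z_1|+1)$-st argument of $\vec u$, and every constant $d\ne c$. (8) $\forall\vec z_1\vec z_2\vec z_3(\mathrm K^0(\vec z_1,c,\vec z_2,d,\vec z_3)\to\overline{\mathrm K}{}^0)$, for every pair $c,d$ of different constants and every clause $K$ with target $\mathrm R(\vec u)$ in which the $(|\vec z_1|+1)$-st and $(|\vec z_1|+1+|\vec z_2|+1)$-st arguments of $\vec u$ are the same variable. (9) $\forall\vec z\vec\nu(\mathrm K^i(\vec z,\vec\nu)\to(\mathrm K^{i+1}(\vec z,\vec\nu,c_1)\to\overline{\mathrm K}{}^{i+1})\to\cdots\to(\mathrm K^{i+1}(\vec z,\vec\nu,c_m)\to\overline{\mathrm K}{}^{i+1})\to\overline{\mathrm K}{}^i)$, for every clause $K(\vec x,\vec y)$ and every prefix $\vec\nu$ of $\vec y$ with $|\vec\nu|=i<|\vec y|$.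 (10) $\forall\vec x\vec y(\mathrm K^{|\vec y|}(\vec u,\vec y)\to(\mathrm P?(\vec v)\to\mathrm{RP}(\vec u,\vec v)\to\circ)\to\overline{\mathrm K}{}^{|\vec y|})$, for every clause $K(\vec x,\vec y)$ with target $\mathrm R(\vec u)$ and every positive atom $\mathrm P(\vec v)$ at its rhs. (11) $\forall\vec x\vec y(\mathrm K^{|\vec y|}(\vec u,\vec y)\to\mathrm S(\vec w)\to\overline{\mathrm K}{}^{|\vec y|})$, for every clause $K(\vec x,\vec y)$ with target $\mathrm R(\vec u)$ and every negative atom $\neg\mathrm S(\vec w)$ at its rhs. (12) $\forall\vec z\vec y\vec w(\mathrm{RP}(\vec z,\vec y)\to\mathrm{PQ}(\vec y,\vec w)\to(\mathrm{RQ}(\vec z,\vec w)\to\circ)\to\circ)$, for all predicates $\mathrm R,\mathrm P,\mathrm Q$ of $\mathcal P$ of arities $|\vec z|,|\vec y|,|\vec w|$. (13) $\forall\vec z(\mathrm{PP}(\vec z,\vec z)\to\circ)$, for every predicate $\mathrm P$ of $\mathcal P$. In (7)–(9) constants range over $D_{\mathcal P}$. -}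

module Defs where

open import Data.Bool using (Bool; T)
open import Data.Fin using (Fin; zero; suc; toℕ; opposite; lift; punchOut; _↑ˡ_; _↑ʳ_; _<_; _<?_; _≟_)
open import Data.Fin.Properties using (toℕ<n; <⇒≢)
open import Data.List using (List; []; _∷_; _++_; [_]; map; foldr; concatMap; allFin; length)
import Data.List as List
open import Data.List.Membership.Propositional using (_∈_)
open import Data.List.Relation.Unary.All using (All)
open import Data.List.Relation.Unary.Any using (Any)
open import Data.Nat using (ℕ; zero; suc; pred; _+_; _≤_; z≤n; NonZero)
open import Data.Nat.Properties using (≤-refl; <⇒≤)
open import Data.Vec using (Vec; []; insertAt; lookup; tabulate; _∷ʳ_)
  renaming (map to mapᵛ; _++_ to _++ᵛ_)
import Data.Vec.Membership.Propositional as Vecᴹ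
open import Function using (_⇔_; _∘_)
open import Relation.Binary.PropositionalEquality using (_≡_; _≢_)
open import Relation.Nullary using (Dec; yes; no; ¬_; ¬?)

------------------------------------------------------------------------
-- Minimal first-order logic with → and ∀, no function symbols.  The only
-- terms are object variables (de Bruijn); S k is the set of k-ary symbols,
-- and Formula S n has its free variables in Fin n.

infixr 6 _⇒_ _⇒*_
infix  3 _⊢_

data Formula (S : ℕ → Set) (n : ℕ) : Set where
  atom : ∀ {k} → S k → Vec (Fin n) k → Formula S n
  _⇒_  : Formula S n → Formula S n → Formula S n
  ∀′   : Formula S (suc n) → Formula S n

rename : ∀ {S n p} → (Fin n → Fin p) → Formula S n → Formula S p
rename ρ (atom s xs) = atom s (mapᵛ ρ xs)
rename ρ (A ⇒ B)     = rename ρ A ⇒ rename ρ B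
rename ρ (∀′ A)      = ∀′ (rename (lift 1 ρ) A)

inst : ∀ {n} → Fin n → Fin (suc n) → Fin n
inst t zero    = t
inst t (suc i) = i

data _⊢_ {S : ℕ → Set} : ∀ {n} → List (Formula S n) → Formula S n → Set where
  hyp : ∀ {n} {Γ : List (Formula S n)} {A} → A ∈ Γ → Γ ⊢ A
  ⇒I  : ∀ {n} {Γ : List (Formula S n)} {A B} → A ∷ Γ ⊢ B → Γ ⊢ A ⇒ B
  ⇒E  : ∀ {n} {Γ : List (Formula S n)} {A B} → Γ ⊢ A ⇒ B → Γ ⊢ A → Γ ⊢ B
  ∀I  : ∀ {n} {Γ : List (Formula S n)} {A} → map (rename suc) Γ ⊢ A → Γ ⊢ ∀′ A
  ∀E  : ∀ {n} {Γ : List (Formula S n)} {A} → Γ ⊢ ∀′ A → (t : Fin n) →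
        Γ ⊢ rename (inst t) A

-- [ A₁ , … , Aₖ ] ⇒* B  is  A₁ ⇒ ⋯ ⇒ Aₖ ⇒ B.
_⇒*_ : ∀ {S n} → List (Formula S n) → Formula S n → Formula S n
As ⇒* B = foldr _⇒_ B As

∀* : ∀ {S n} k → Formula S (k + n) → Formula S n
∀* zero    A = A
∀* (suc k) A = ∀* k (∀′ A)

-- The j-th variable bound by a block ∀* k, counted from the outermost
-- quantifier, hence the reversal of the de Bruijn index.
bvar : ∀ {k n} → Fin k → Fin (k + n)
bvar {n = n} j = opposite j ↑ˡ n

bvars : ∀ {k n} → Vec (Fin (k + n)) k
bvars = tabulate bvar

------------------------------------------------------------------------
-- Logic programs with negation

record Language : Set where
  field
    #const   : ℕ
    nonempty : NonZero #const
    #pred    : ℕ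
    arity    : Fin #pred → ℕ

  Const : Set
  Const = Fin #const

  Pred : Set
  Pred = Fin #pred

module _ (L : Language) where
  open Language L

  data Term (n : ℕ) : Set where
    con : Const → Term n
    var : Fin n → Term n

  record Atom (X : Set) : Set where
    constructor _⟨_⟩
    field
      predicate : Pred
      args      : Vec X (arity predicate)

  -- A clause K(x⃗,y⃗) with target predicate R.  The variables of x⃗ are
  -- 0 , … , nx-1; in the rhs those of y⃗ are nx , … , nx+ny-1.  The two
  -- occurrence conditions say that x⃗ consists of exactly the variables of
  -- u⃗ and y⃗ of exactly the remaining variables of the rhs.
  record Clause (R : Pred) : Set where
    field
      nx ny    : ℕ
      u        : Vec (Term nx) (arity R)
      positive : List (Atom (Term (nx + ny)))
      negative : List (Atom (Term (nx + ny)))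
      x-occurs : ∀ (i : Fin nx) → var i Vecᴹ.∈ u
      y-occurs : ∀ (j : Fin ny) →
                 Any (λ a → var (nx ↑ʳ j) Vecᴹ.∈ Atom.args a) (positive ++ negative)

module _ {L : Language} where

  mapAtom : ∀ {X Y} → (X → Y) → Atom L X → Atom L Y
  mapAtom f (R ⟨ xs ⟩) = R ⟨ mapᵛ f xs ⟩

  weakenTerm : ∀ {n} k → Term L n → Term L (n + k)
  weakenTerm k (con c) = con c
  weakenTerm k (var i) = var (i ↑ˡ k)

-- The clauses are grouped by their target predicate.
record Program : Set where
  field
    language : Language
  open Language language public
  field
    rules : ∀ R → List (Clause language R)

  Rule : Pred → Set
  Rule R = Fin (length (rules R))

  rule : ∀ {R} → Rule R → Clause language R
  rule {R} = List.lookup (rules R)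

------------------------------------------------------------------------
-- Stable models

module _ (P : Program) where
  open Program P

  GroundAtom : Set
  GroundAtom = Atom language Const

  -- Subsets of the finite set of ground atoms, by characteristic functions.
  Model : Set
  Model = GroundAtom → Bool

  infix 4 _∈ᴹ_ _∉ᴹ_

  _∈ᴹ_ _∉ᴹ_ : GroundAtom → Model → Set
  a ∈ᴹ M = T (M a)
  a ∉ᴹ M = ¬ (a ∈ᴹ M)

  groundTerm : ∀ {n} → (Fin n → Const) → Term language n → Const
  groundTerm θ (con c) = c
  groundTerm θ (var i) = θ i

  ground : ∀ {n} → (Fin n → Const) → Atom language (Term language n) → GroundAtom
  ground θ = mapAtom (groundTerm θ)

  -- Reduct M a as : the clause  a :- as  belongs to P^M.
  data Reduct (M : Model) : GroundAtom → List GroundAtom → Set where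
    reduct : ∀ {R} (r : Rule R) → let open Clause (rule r) in
             (θ : Fin (nx + ny) → Const) →
             All (_∉ᴹ M) (map (ground θ) negative) →
             Reduct M (ground θ (R ⟨ mapᵛ (weakenTerm ny) u ⟩)) (map (ground θ) positive)

  -- The least fixed point I(P,M).
  data I (M : Model) : GroundAtom → Set where
    derive : ∀ {a as} → Reduct M a as → All (I M) as → I M a

  Stable : Model → Set
  Stable M = ∀ a → a ∈ᴹ M ⇔ I M a

  Entails : GroundAtom → Set
  Entails Ω = ∀ (M : Model) → Stable M → Ω ∈ᴹ M

------------------------------------------------------------------------
-- The formula φ

when : ∀ {A B : Set} → Dec A → (A → List B) → List B
when (yes a) f = f a
when (no _)  f = []

-- fill p c (z⃗₁ ++ z⃗₂) = (z⃗₁ , c , z⃗₂), where |z⃗₁| = p.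
fill : ∀ {A : Set} {l} → Fin l → A → Vec A (pred l) → Vec A l
fill {l = suc _} p c zs = insertAt zs p c

-- For p < q, fill₂ puts c at position p and d at position q of the result.
fill₂ : ∀ {A : Set} {l} (p q : Fin l) → p < q → A → A → Vec A (pred (pred l)) → Vec A l
fill₂ {l = suc _} p q p<q c d zs = fill p c (fill (punchOut (<⇒≢ p<q)) d zs)

module Encoding (P : Program) where
  open Program P

  |y| : ∀ {R} → Rule R → ℕ
  |y| r = Clause.ny (rule r)

  data Symbol : ℕ → Set where
    pos bar bang query : (R : Pred) → Symbol (arity R)
    pair               : (R Q : Pred) → Symbol (arity R + arity Q)
    K                  : ∀ {R} (r : Rule R) (i : ℕ) → .(i ≤ |y| r) → Symbol (arity R + i)
    K̄                  : ∀ {R} (r : Rule R) (i : ℕ) → .(i ≤ |y| r) → Symbol 0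
    loop A B ∘′ •′     : Symbol 0

  Fml : ℕ → Set
  Fml = Formula Symbol

  prop : ∀ {n} → Symbol 0 → Fml n
  prop s = atom s []

  -- The constants are the free variables of φ; constant k seen from under
  -- k quantifiers:
  constant : ∀ k → Const → Fin (k + #const)
  constant k c = k ↑ʳ c

  ⟦_⟧ : ∀ {k} → Term language k → Fin (k + #const)
  ⟦_⟧ {k} (con c) = constant k c
  ⟦_⟧     (var i) = bvar i

  ⟦_⟧* : ∀ {k l} → Vec (Term language k) l → Vec (Fin (k + #const)) l
  ⟦_⟧* = mapᵛ ⟦_⟧

  axiom1 : Pred → Fml #const
  axiom1 R = ∀* (arity R)
    ((atom (pos R) bvars ⇒ prop loop) ⇒ (atom (bar R) bvars ⇒ prop loop) ⇒ prop loop)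

  axioms2 : GroundAtom P → List (Fml #const)
  axioms2 (R ⟨ cs ⟩) =
      (atom (pos R) cs ⇒ prop loop)
    ∷ (prop A ⇒ prop loop)
    ∷ (prop B ⇒ prop loop)
    ∷ []

  axiom3 : Pred → Fml #const
  axiom3 R = ∀* (arity R)
    (atom (bar R) bvars ⇒ (atom (bang R) bvars ⇒ prop •′) ⇒ prop A)

  axiom4 : Pred → Fml #const
  axiom4 R = ∀* (arity R)
    (atom (pos R) bvars ⇒ (atom (query R) bvars ⇒ prop ∘′) ⇒ prop B)

  module _ {R : Pred} (r : Rule R) where
    open Clause (rule r)

    l : ℕ
    l = arity R

    uᴷ : Vec (Fin ((nx + ny) + #const)) l
    uᴷ = ⟦ mapᵛ (weakenTerm ny) u ⟧*

    yᴷ : Vec (Fin ((nx + ny) + #const)) ny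
    yᴷ = tabulate (λ j → bvar (nx ↑ʳ j))

    axiom5 : Fml #const
    axiom5 = ∀* (nx + ny)
      ( atom (bang R) uᴷ
      ⇒ map (λ (Q ⟨ v ⟩) → atom (bang Q) ⟦ v ⟧* ⇒ prop •′) positive
      ⇒* map (λ (S ⟨ w ⟩) → atom (bar S) ⟦ w ⟧*) negative
      ⇒* prop •′)

    axiom7 : Fin l → Const → Fml #const
    axiom7 p d = ∀* (pred l)
      (atom (K r 0 z≤n) (fill p (constant (pred l) d) bvars ++ᵛ []) ⇒ prop (K̄ r 0 z≤n))

    axioms7At : Fin l → Term language nx → List (Fml #const)
    axioms7At p (con c) = concatMap (λ d → when (¬? (d ≟ c)) λ _ → [ axiom7 p d ]) (allFin #const)
    axioms7At p (var _) = []

    axioms7 : List (Fml #const)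
    axioms7 = concatMap (λ p → axioms7At p (lookup u p)) (allFin l)

    axiom8 : (p q : Fin l) → p < q → Const → Const → Fml #const
    axiom8 p q p<q c d = ∀* (pred (pred l))
      ( atom (K r 0 z≤n) (fill₂ p q p<q (constant _ c) (constant _ d) bvars ++ᵛ [])
      ⇒ prop (K̄ r 0 z≤n))

    axioms8At : (p q : Fin l) → p < q → Term language nx → Term language nx → List (Fml #const)
    axioms8At p q p<q (var i) (var j) = when (i ≟ j) λ _ →
      concatMap (λ c → concatMap (λ d → when (¬? (c ≟ d)) λ _ →
        [ axiom8 p q p<q c d ]) (allFin #const)) (allFin #const)
    axioms8At p q p<q (var i) (con c) = []
    axioms8At p q p<q (con c) t       = []

    axioms8 : List (Fml #const)
    axioms8 = concatMap (λ p → concatMap (λ q → when (p <? q) λ p<q →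
      axioms8At p q p<q (lookup u p) (lookup u q)) (allFin l)) (allFin l)

    axiom9 : Fin ny → Fml #const
    axiom9 i = ∀* (l + toℕ i)
      ( atom (K r (toℕ i) (<⇒≤ (toℕ<n i))) (z⃗ ++ᵛ ν⃗)
      ⇒ map (λ c → atom (K r (suc (toℕ i)) (toℕ<n i)) (z⃗ ++ᵛ (ν⃗ ∷ʳ constant _ c))
                 ⇒ prop (K̄ r (suc (toℕ i)) (toℕ<n i)))
            (allFin #const)
      ⇒* prop (K̄ r (toℕ i) (<⇒≤ (toℕ<n i))))
      where
      z⃗ = tabulate (λ j → bvar (j ↑ˡ toℕ i))
      ν⃗ = tabulate (λ j → bvar (l ↑ʳ j))

    axiom10 : Atom language (Term language (nx + ny)) → Fml #const
    axiom10 (Q ⟨ v ⟩) = ∀* (nx + ny)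
      ( atom (K r ny ≤-refl) (uᴷ ++ᵛ yᴷ)
      ⇒ (atom (query Q) ⟦ v ⟧* ⇒ atom (pair R Q) (uᴷ ++ᵛ ⟦ v ⟧*) ⇒ prop ∘′)
      ⇒ prop (K̄ r ny ≤-refl))

    axiom11 : Atom language (Term language (nx + ny)) → Fml #const
    axiom11 (S ⟨ w ⟩) = ∀* (nx + ny)
      ( atom (K r ny ≤-refl) (uᴷ ++ᵛ yᴷ)
      ⇒ atom (pos S) ⟦ w ⟧*
      ⇒ prop (K̄ r ny ≤-refl))

  axiom6 : Pred → Fml #const
  axiom6 R = ∀* (arity R)
    ( atom (query R) bvars
    ⇒ map (λ r → atom (K r 0 z≤n) (bvars ++ᵛ []) ⇒ prop (K̄ r 0 z≤n))
          (allFin (length (rules R)))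
    ⇒* prop ∘′)

  axiom12 : Pred → Pred → Pred → Fml #const
  axiom12 R Q S = ∀* (arity R + (arity Q + arity S))
    ( atom (pair R Q) (z⃗ ++ᵛ y⃗)
    ⇒ atom (pair Q S) (y⃗ ++ᵛ w⃗)
    ⇒ (atom (pair R S) (z⃗ ++ᵛ w⃗) ⇒ prop ∘′)
    ⇒ prop ∘′)
    where
    z⃗ = tabulate (λ j → bvar (j ↑ˡ (arity Q + arity S)))
    y⃗ = tabulate (λ j → bvar (arity R ↑ʳ (j ↑ˡ arity S)))
    w⃗ = tabulate (λ j → bvar (arity R ↑ʳ (arity Q ↑ʳ j)))

  axiom13 : Pred → Fml #const
  axiom13 Q = ∀* (arity Q) (atom (pair Q Q) (z⃗ ++ᵛ z⃗) ⇒ prop ∘′)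
    where
    z⃗ = bvars {arity Q} {#const}

  forPreds : (Pred → List (Fml #const)) → List (Fml #const)
  forPreds f = concatMap f (allFin #pred)

  forRules : (∀ {R} → Rule R → List (Fml #const)) → List (Fml #const)
  forRules f = forPreds λ R → concatMap (f {R}) (allFin (length (rules R)))

  axioms : GroundAtom P → List (Fml #const)
  axioms Ω =
       forPreds (λ R → [ axiom1 R ])
    ++ axioms2 Ω
    ++ forPreds (λ R → [ axiom3 R ])
    ++ forPreds (λ R → [ axiom4 R ])
    ++ forRules (λ r → [ axiom5 r ])
    ++ forPreds (λ R → [ axiom6 R ])
    ++ forRules (λ r → axioms7 r)
    ++ forRules (λ r → axioms8 r)
    ++ forRules (λ r → map (axiom9 r) (allFin (|y| r)))
    ++ forRules (λ r → map (axiom10 r) (Clause.positive (rule r)))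
    ++ forRules (λ r → map (axiom11 r) (Clause.negative (rule r)))
    ++ forPreds (λ R → forPreds λ Q → forPreds λ S → [ axiom12 R Q S ])
    ++ forPreds (λ Q → [ axiom13 Q ])

  φ : GroundAtom P → Fml #const
  φ Ω = axioms Ω ⇒* prop loop

open Encoding public using (φ)

module Submission where

-- Provable ⇒ entailed: a stable model M omitting Ω would make φ false in the two-valued
-- structure with domain the constants where all of loop, A, B, ∘, • and K̄ are false,
-- P and P? mean membership in M, P̄ and P! mean non-membership, PQ(a,b) says that b is
-- derived strictly earlier than a in I(P,M), and Kⁱ(z,ν) that some instance of K with
-- head z, whose values for y⃗ begin with ν, derives z from earlier atoms.
--
-- Entailed ⇒ provable: axiom (1) splits on every ground atom, so one may assume the
-- literals of some model M.  If M is stable then Ω ∈ M gives loop by (2).  A rule instance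
-- violated by M gives a ∉ M in I(P,M), whose derivation turns a! into • by (5); an a ∈ M is
-- either in I(P,M) or refuted from a? by a loop-checked search using (6)–(13).  Deciding
-- between a derivation in I(P,M) and such a refutation makes the argument constructive.

open import Defs
open import Data.Bool using (Bool; true; false; T; T?)
open import Data.Empty using (⊥; ⊥-elim)
open import Data.Fin
  using (Fin; zero; suc; #_; toℕ; fromℕ; fromℕ<; inject₁; opposite; lift; splitAt; join;
         punchOut; _↑ˡ_; _↑ʳ_; _<_; _<?_; _≟_)
open import Data.Fin.Properties
  using (toℕ<n; toℕ-injective; toℕ-inject₁; toℕ-fromℕ; toℕ-fromℕ<; opposite-involutive;
         splitAt-↑ˡ; splitAt-↑ʳ; join-splitAt; punchIn-punchOut; <⇒≢; <-cmp; <-irrelevant)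
open import Data.Fin.Relation.Unary.Top using (View; view; ‵fromℕ; ‵inject₁)
open import Data.List
  using (List; []; _∷_; [_]; _++_; map; length; concatMap; allFin; cartesianProductWith)
import Data.List as List
open import Data.List.Membership.Propositional using (_∈_; lose; find)
open import Data.List.Membership.Propositional.Properties
  using (∈-allFin; ∈-concatMap⁺; ∈-++⁺ˡ; ∈-++⁺ʳ; ∈-map⁺; ∈-cartesianProductWith⁺)
open import Data.List.Relation.Binary.Subset.Propositional using (_⊆_)
open import Data.List.Relation.Unary.All as All using (All; []; _∷_)
import Data.List.Relation.Unary.All.Properties as Allₚ
open import Data.List.Relation.Unary.Any as Any using (here; there)
open import Data.Nat using (ℕ; zero; suc; pred; _+_; _⊔_; _≤_; z≤n; s≤s)
open import Data.Nat.Properties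
  using (≤-refl; ≤-total; <⇒≤; m≤m⊔n; m≤n⊔m; m≤n+m; +-suc; +-identityʳ; suc-injective)
open import Data.Product using (∃; _×_; _,_; proj₁; proj₂)
open import Data.Sum as Sum using (_⊎_; inj₁; inj₂; [_,_]′)
open import Data.Vec
  using (Vec; []; _∷_; _∷ʳ_; tabulate; lookup; take; drop; insertAt; removeAt)
  renaming (map to mapᵛ; _++_ to _++ᵛ_)
open import Data.Vec.Properties
  using (map-cong; map-∘; map-id; map-++; map-∷ʳ; map-insertAt; lookup-map; lookup-++ˡ;
         lookup-++ʳ; tabulate-∘; tabulate-cong; lookup∘tabulate; tabulate∘lookup;
         insertAt-lookup; insertAt-punchIn; insertAt-removeAt; removeAt-punchOut)
import Data.Vec.Relation.Unary.Any as Anyᵛ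
import Data.Vec.Relation.Unary.Any.Properties as Anyᵛₚ
open import Function using (_∘_; id; _⇔_; mk⇔; Equivalence)
open import Relation.Binary using (tri<; tri≈; tri>)
open import Relation.Binary.PropositionalEquality
  using (_≡_; _≢_; _≗_; refl; sym; trans; cong; cong₂; subst; subst₂)
open import Relation.Nullary using (¬_; Dec; yes; no; ¬?; contradiction; decidable-stable)
open import Relation.Nullary.Decidable using (toSum)

-- Minimal logic

module _ {S : ℕ → Set} where

  lift-cong : ∀ {n p} {ρ σ : Fin n → Fin p} → ρ ≗ σ → lift 1 ρ ≗ lift 1 σ
  lift-cong eq zero    = refl
  lift-cong eq (suc i) = cong suc (eq i)

  rename-cong : ∀ {n p} {ρ σ : Fin n → Fin p} → ρ ≗ σ →
                (A : Formula S n) → rename ρ A ≡ rename σ A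
  rename-cong eq (atom s xs) = cong (atom s) (map-cong eq xs)
  rename-cong eq (A ⇒ B)     = cong₂ _⇒_ (rename-cong eq A) (rename-cong eq B)
  rename-cong eq (∀′ A)      = cong ∀′ (rename-cong (lift-cong eq) A)

  rename-∘ : ∀ {n p q} (ρ : Fin p → Fin q) (σ : Fin n → Fin p) (A : Formula S n) →
             rename ρ (rename σ A) ≡ rename (ρ ∘ σ) A
  rename-∘ ρ σ (atom s xs) = cong (atom s) (sym (map-∘ ρ σ xs))
  rename-∘ ρ σ (A ⇒ B)     = cong₂ _⇒_ (rename-∘ ρ σ A) (rename-∘ ρ σ B)
  rename-∘ ρ σ (∀′ A)      = cong ∀′ (trans (rename-∘ (lift 1 ρ) (lift 1 σ) A)
    (rename-cong (λ { zero → refl ; (suc i) → refl }) A))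

  rename-id : ∀ {n} {ρ : Fin n → Fin n} → (∀ i → ρ i ≡ i) → (A : Formula S n) → rename ρ A ≡ A
  rename-id eq (atom s xs) = cong (atom s) (trans (map-cong eq xs) (map-id xs))
  rename-id eq (A ⇒ B)     = cong₂ _⇒_ (rename-id eq A) (rename-id eq B)
  rename-id eq (∀′ A)      = cong ∀′ (rename-id (λ { zero → refl ; (suc i) → cong suc (eq i) }) A)

  rename-map-⇒* : ∀ {n p} {ρ : Fin n → Fin p} {X : Set} (F : X → Formula S n) {G B B′} →
                  rename ρ ∘ F ≗ G → rename ρ B ≡ B′ →
                  ∀ xs → rename ρ (map F xs ⇒* B) ≡ map G xs ⇒* B′
  rename-map-⇒* F eq eq′ []       = eq′
  rename-map-⇒* F eq eq′ (x ∷ xs) = cong₂ _⇒_ (eq x) (rename-map-⇒* F eq eq′ xs)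

  ⇒*E : ∀ {n} {Γ : List (Formula S n)} {As B} → Γ ⊢ As ⇒* B → All (Γ ⊢_) As → Γ ⊢ B
  ⇒*E d []       = d
  ⇒*E d (e ∷ es) = ⇒*E (⇒E d e) es

  -- The premises enter the context one by one; the body sees the result only as some `Δ` containing
  -- `Γ` and all of `As`, which hides the order of insertion.
  ⇒*I : ∀ {n} {Γ : List (Formula S n)} As {B} →
        (∀ Δ → Γ ⊆ Δ → All (_∈ Δ) As → Δ ⊢ B) → Γ ⊢ As ⇒* B
  ⇒*I []       d = d _ id []
  ⇒*I (A ∷ As) d = ⇒I (⇒*I As λ Δ Γ⊆Δ As⊆Δ → d Δ (Γ⊆Δ ∘ there) (Γ⊆Δ (here refl) ∷ As⊆Δ))

  -- The substitution `η` instantiates the whole block and fixes the free variables. Since `∀*` adds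
  -- new quantifiers innermost, the recursion first treats the outer ones along `η ∘ suc` and then
  -- the variable `zero`.
  ∀*E : ∀ {n} {Γ : List (Formula S n)} k {A} (η : Fin (k + n) → Fin n) →
        (∀ j → η (k ↑ʳ j) ≡ j) → Γ ⊢ ∀* k A → Γ ⊢ rename η A
  ∀*E zero    {A} η free d = subst (_ ⊢_) (sym (rename-id free A)) d
  ∀*E (suc k) {A} η free d =
    subst (_ ⊢_)
      (trans (rename-∘ (inst (η zero)) (lift 1 (η ∘ suc)) A)
             (rename-cong (λ { zero → refl ; (suc i) → refl }) A))
      (∀E (∀*E k (η ∘ suc) free d) (η zero))

-- Tarski semantics and soundness

module Tarski {S : ℕ → Set} {X : Set} (⟪_⟫ : ∀ {k} → S k → Vec X k → Set) where

  infix 3 _⊨_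

  _◂_ : ∀ {n} → X → (Fin n → X) → Fin (suc n) → X
  (x ◂ ρ) zero    = x
  (x ◂ ρ) (suc i) = ρ i

  _⊨_ : ∀ {n} → (Fin n → X) → Formula S n → Set
  ρ ⊨ atom s xs = ⟪ s ⟫ (mapᵛ ρ xs)
  ρ ⊨ A ⇒ B     = ρ ⊨ A → ρ ⊨ B
  ρ ⊨ ∀′ A      = ∀ x → x ◂ ρ ⊨ A

  ◂-lift : ∀ {n p} {σ : Fin n → Fin p} {ρ τ} → ρ ∘ σ ≗ τ → ∀ x → (x ◂ ρ) ∘ lift 1 σ ≗ x ◂ τ
  ◂-lift eq x zero    = refl
  ◂-lift eq x (suc i) = eq i

  ⊨-rename⁺ : ∀ {n p} {σ : Fin n → Fin p} {ρ τ} → ρ ∘ σ ≗ τ → ∀ A → τ ⊨ A → ρ ⊨ rename σ A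
  ⊨-rename⁻ : ∀ {n p} {σ : Fin n → Fin p} {ρ τ} → ρ ∘ σ ≗ τ → ∀ A → ρ ⊨ rename σ A → τ ⊨ A
  ⊨-rename⁺ eq (atom s xs) = subst ⟪ s ⟫ (trans (sym (map-cong eq xs)) (map-∘ _ _ xs))
  ⊨-rename⁺ eq (A ⇒ B) f   = ⊨-rename⁺ eq B ∘ f ∘ ⊨-rename⁻ eq A
  ⊨-rename⁺ eq (∀′ A) f x  = ⊨-rename⁺ (◂-lift eq x) A (f x)
  ⊨-rename⁻ eq (atom s xs) = subst ⟪ s ⟫ (trans (sym (map-∘ _ _ xs)) (map-cong eq xs))
  ⊨-rename⁻ eq (A ⇒ B) f   = ⊨-rename⁻ eq B ∘ f ∘ ⊨-rename⁺ eq A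
  ⊨-rename⁻ eq (∀′ A) f x  = ⊨-rename⁻ (◂-lift eq x) A (f x)

  sound : ∀ {n} {Γ : List (Formula S n)} {A} → Γ ⊢ A → ∀ {ρ} → All (ρ ⊨_) Γ → ρ ⊨ A
  sound (hyp A∈Γ) ⊨Γ       = All.lookup ⊨Γ A∈Γ
  sound (⇒I d) ⊨Γ a        = sound d (a ∷ ⊨Γ)
  sound (⇒E d e) ⊨Γ        = sound d ⊨Γ (sound e ⊨Γ)
  sound (∀I d) ⊨Γ x        = sound d (Allₚ.map⁺ (All.map (λ {A} → ⊨-rename⁺ (λ _ → refl) A) ⊨Γ))
  sound (∀E {A = A} d t) ⊨Γ =
    ⊨-rename⁺ (λ { zero → refl ; (suc i) → refl }) A (sound d ⊨Γ _)

  ⊨-⇒*⁺ : ∀ {n} {ρ : Fin n → X} As {B} → (All (ρ ⊨_) As → ρ ⊨ B) → ρ ⊨ As ⇒* B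
  ⊨-⇒*⁺ []       f   = f []
  ⊨-⇒*⁺ (A ∷ As) f a = ⊨-⇒*⁺ As (f ∘ (a ∷_))

  ⊨-⇒*⁻ : ∀ {n} {ρ : Fin n → X} {As B} → ρ ⊨ As ⇒* B → All (ρ ⊨_) As → ρ ⊨ B
  ⊨-⇒*⁻ f []       = f
  ⊨-⇒*⁻ f (a ∷ as) = ⊨-⇒*⁻ (f a) as

  ⊨-∀* : ∀ {n} {ρ : Fin n → X} k {A} →
         (∀ η → (∀ j → η (k ↑ʳ j) ≡ ρ j) → η ⊨ A) → ρ ⊨ ∀* k A
  ⊨-∀* zero    f = f _ (λ _ → refl)
  ⊨-∀* (suc k) f = ⊨-∀* k λ η free x → f (x ◂ η) free

-- Instantiating a block of quantifiers

record _Extends_ {k n} (η : Fin (k + n) → Fin n) (θ : Fin k → Fin n) : Set where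
  field
    bound : ∀ j → η (bvar j) ≡ θ j
    free  : ∀ c → η (k ↑ʳ c) ≡ c

-- This `opposite` undoes the reversal built into `bvar`, so that `θ` lists the values from the
-- outermost quantifier inwards.
assign : ∀ {k n} → (Fin k → Fin n) → Fin (k + n) → Fin n
assign {k} θ i = [ θ ∘ opposite , id ]′ (splitAt k i)

assign-extends : ∀ {k n} (θ : Fin k → Fin n) → assign θ Extends θ
assign-extends {k} {n} θ = record
  { bound = λ j → trans (cong [ θ ∘ opposite , id ]′ (splitAt-↑ˡ k (opposite j) n))
                        (cong θ (opposite-involutive j))
  ; free  = λ c → cong [ θ ∘ opposite , id ]′ (splitAt-↑ʳ k n c)
  }

-- Ground instances of the axioms

-- Computes the instances of an axiom once for both directions of the theorem: `instance-⊢` derives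
-- them from the axiom, and `schema-valid` infers the truth of the axiom from theirs.
data Schema {S n} : Formula S n → (k : ℕ) → ((Fin k → Fin n) → Formula S n) → Set where
  schema : ∀ {k A G} → (∀ {θ η} → η Extends θ → rename η A ≡ G θ) → Schema (∀* k A) k G

instance-⊢ : ∀ {S n k} {A : Formula S n} {G Γ} → Schema A k G → A ∈ Γ → ∀ θ → Γ ⊢ G θ
instance-⊢ {k = k} (schema eq) A∈Γ θ =
  subst (_ ⊢_) (eq ext) (∀*E k (assign θ) (_Extends_.free ext) (hyp A∈Γ))
  where ext = assign-extends θ

map-fill : ∀ {X Y : Set} (f : X → Y) {l} (p : Fin l) {x} zs →
           mapᵛ f (fill p x zs) ≡ fill p (f x) (mapᵛ f zs)
map-fill f {suc l} p zs = map-insertAt f _ zs p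

map-fill₂ : ∀ {X Y : Set} (f : X → Y) {l} (p q : Fin l) (p<q : p < q) {x y} zs →
            mapᵛ f (fill₂ p q p<q x y zs) ≡ fill₂ p q p<q (f x) (f y) (mapᵛ f zs)
map-fill₂ f {suc l} p q p<q zs =
  trans (map-fill f p _) (cong (fill p _) (map-fill f _ zs))

module Ground (P : Program) where
  open Program P
  open Encoding P hiding (φ)
  open Atom
  open _Extends_

  posᵃ barᵃ bangᵃ queryᵃ : GroundAtom P → Fml #const
  posᵃ   a = atom (pos (predicate a)) (args a)
  barᵃ   a = atom (bar (predicate a)) (args a)
  bangᵃ  a = atom (bang (predicate a)) (args a)
  queryᵃ a = atom (query (predicate a)) (args a)

  pairᵃ : GroundAtom P → GroundAtom P → Fml #const
  pairᵃ a b = atom (pair (predicate a) (predicate b)) (args a ++ᵛ args b)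

  literal : GroundAtom P → Bool → Fml #const
  literal a true  = posᵃ a
  literal a false = barᵃ a

  head : ∀ {R} (r : Rule R) → let open Clause (rule r) in (Fin (nx + ny) → Const) → GroundAtom P
  head {R} r θ = ground P θ (R ⟨ mapᵛ (weakenTerm (|y| r)) (Clause.u (rule r)) ⟩)

  yᵍ : ∀ {R} (r : Rule R) → let open Clause (rule r) in (Fin (nx + ny) → Const) → Vec Const ny
  yᵍ r θ = tabulate (θ ∘ (Clause.nx (rule r) ↑ʳ_))

  ax1 ax3 ax4 ax13 : GroundAtom P → Fml #const
  ax1 a  = (posᵃ a ⇒ prop loop) ⇒ (barᵃ a ⇒ prop loop) ⇒ prop loop
  ax3 a  = barᵃ a ⇒ (bangᵃ a ⇒ prop •′) ⇒ prop A
  ax4 a  = posᵃ a ⇒ (queryᵃ a ⇒ prop ∘′) ⇒ prop B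
  ax13 a = pairᵃ a a ⇒ prop ∘′

  ax5 : ∀ {R} (r : Rule R) → let open Clause (rule r) in (Fin (nx + ny) → Const) → Fml #const
  ax5 r θ =
    bangᵃ (head r θ)
    ⇒ map (λ b → bangᵃ (ground P θ b) ⇒ prop •′) positive
    ⇒* map (λ b → barᵃ (ground P θ b)) negative
    ⇒* prop •′
    where open Clause (rule r)

  -- The common form of the axioms (7) and (8).
  reject : ∀ {R} → Rule R → Vec Const (arity R) → Fml #const
  reject r z = atom (K r 0 z≤n) (z ++ᵛ []) ⇒ prop (K̄ r 0 z≤n)

  ax6 : GroundAtom P → Fml #const
  ax6 (R ⟨ z ⟩) = queryᵃ (R ⟨ z ⟩) ⇒ map (λ r → reject {R} r z) (allFin _) ⇒* prop ∘′

  ax9 : ∀ {R} (r : Rule R) (i : Fin (|y| r)) → Vec Const (arity R) → Vec Const (toℕ i) → Fml #const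
  ax9 r i z ν =
    atom (K r (toℕ i) (<⇒≤ (toℕ<n i))) (z ++ᵛ ν)
    ⇒ map (λ c → atom (K r (suc (toℕ i)) (toℕ<n i)) (z ++ᵛ (ν ∷ʳ c))
               ⇒ prop (K̄ r (suc (toℕ i)) (toℕ<n i)))
          (allFin #const)
    ⇒* prop (K̄ r (toℕ i) (<⇒≤ (toℕ<n i)))

  ax10 ax11 : ∀ {R} (r : Rule R) → Vec Const (arity R) → Vec Const (|y| r) →
              GroundAtom P → Fml #const
  ax10 {R} r z ν b =
    atom (K r (|y| r) ≤-refl) (z ++ᵛ ν)
    ⇒ (queryᵃ b ⇒ pairᵃ (R ⟨ z ⟩) b ⇒ prop ∘′)
    ⇒ prop (K̄ r (|y| r) ≤-refl)
  ax11 r z ν b = atom (K r (|y| r) ≤-refl) (z ++ᵛ ν) ⇒ posᵃ b ⇒ prop (K̄ r (|y| r) ≤-refl)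

  ax12 : GroundAtom P → GroundAtom P → GroundAtom P → Fml #const
  ax12 a b c = pairᵃ a b ⇒ pairᵃ b c ⇒ (pairᵃ a c ⇒ prop ∘′) ⇒ prop ∘′

  module _ {k} {η : Fin (k + #const) → Const} {θ : Fin k → Const} (ext : η Extends θ) where

    map-tabulate-bvar : ∀ {m} (f : Fin m → Fin k) → mapᵛ η (tabulate (bvar ∘ f)) ≡ tabulate (θ ∘ f)
    map-tabulate-bvar f = trans (sym (tabulate-∘ η (bvar ∘ f))) (tabulate-cong (bound ext ∘ f))

    map-bvars : mapᵛ η bvars ≡ tabulate θ
    map-bvars = map-tabulate-bvar id

    map-⟦⟧ : η ∘ ⟦_⟧ ≗ groundTerm P θ
    map-⟦⟧ (con c) = free ext c
    map-⟦⟧ (var i) = bound ext i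

    map-⟦⟧* : ∀ {m} (v : Vec (Term language k) m) → mapᵛ η ⟦ v ⟧* ≡ mapᵛ (groundTerm P θ) v
    map-⟦⟧* v = trans (sym (map-∘ η ⟦_⟧ v)) (map-cong map-⟦⟧ v)

    map-++₂ : ∀ {m n} {v : Vec _ m} {w : Vec _ n} {v′ w′} →
              mapᵛ η v ≡ v′ → mapᵛ η w ≡ w′ → mapᵛ η (v ++ᵛ w) ≡ v′ ++ᵛ w′
    map-++₂ {v = v} eq eq′ = trans (map-++ η v _) (cong₂ _++ᵛ_ eq eq′)

  schema1 : ∀ R → Schema (axiom1 R) (arity R) (λ θ → ax1 (R ⟨ tabulate θ ⟩))
  schema1 R = schema λ ext → cong (λ z → ax1 (R ⟨ z ⟩)) (map-bvars ext)

  schema3 : ∀ R → Schema (axiom3 R) (arity R) (λ θ → ax3 (R ⟨ tabulate θ ⟩))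
  schema3 R = schema λ ext → cong (λ z → ax3 (R ⟨ z ⟩)) (map-bvars ext)

  schema4 : ∀ R → Schema (axiom4 R) (arity R) (λ θ → ax4 (R ⟨ tabulate θ ⟩))
  schema4 R = schema λ ext → cong (λ z → ax4 (R ⟨ z ⟩)) (map-bvars ext)

  schema5 : ∀ {R} (r : Rule R) → Schema (axiom5 r) _ (ax5 r)
  schema5 {R} r = schema λ ext →
    cong₂ _⇒_ (cong (atom (bang R)) (map-⟦⟧* ext _))
      (rename-map-⇒* (λ b → atom (bang (predicate b)) ⟦ args b ⟧* ⇒ prop •′)
        (λ b → cong (λ v → atom _ v ⇒ prop •′) (map-⟦⟧* ext (args b)))
        (rename-map-⇒* (λ b → atom (bar (predicate b)) ⟦ args b ⟧*)
          (λ b → cong (atom _) (map-⟦⟧* ext (args b))) refl negative)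
        positive)
    where open Clause (rule r)

  schema6 : ∀ R → Schema (axiom6 R) (arity R) (λ θ → ax6 (R ⟨ tabulate θ ⟩))
  schema6 R = schema λ ext →
    cong₂ _⇒_ (cong (atom (query R)) (map-bvars ext))
      (rename-map-⇒* (λ r → atom (K r 0 z≤n) (bvars ++ᵛ []) ⇒ prop (K̄ r 0 z≤n))
        (λ r → cong (λ v → atom _ v ⇒ prop (K̄ r 0 z≤n)) (map-++₂ ext (map-bvars ext) refl))
        refl (allFin _))

  schema7 : ∀ {R} (r : Rule R) p d →
            Schema (axiom7 r p d) (pred (arity R)) (λ θ → reject r (fill p d (tabulate θ)))
  schema7 r p d = schema λ {θ} {η} ext →
    cong (λ v → atom (K r 0 z≤n) v ⇒ prop (K̄ r 0 z≤n))
      (map-++₂ ext (trans (map-fill η p _) (cong₂ (fill p) (free ext d) (map-bvars ext))) refl)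

  schema8 : ∀ {R} (r : Rule R) p q p<q c d →
            Schema (axiom8 r p q p<q c d) (pred (pred (arity R)))
                   (λ θ → reject r (fill₂ p q p<q c d (tabulate θ)))
  schema8 r p q p<q c d = schema λ {θ} {η} ext →
    cong (λ v → atom (K r 0 z≤n) v ⇒ prop (K̄ r 0 z≤n))
      (map-++₂ ext
        (trans (map-fill₂ η p q p<q _)
          (trans (cong₂ (λ x y → fill₂ p q p<q x y _) (free ext c) (free ext d))
                 (cong (fill₂ p q p<q c d) (map-bvars ext))))
        refl)

  schema9 : ∀ {R} (r : Rule R) i → Schema (axiom9 r i) (arity R + toℕ i)
            (λ θ → ax9 r i (tabulate (θ ∘ (_↑ˡ toℕ i))) (tabulate (θ ∘ (arity R ↑ʳ_))))
  schema9 {R} r i = schema λ {θ} {η} ext →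
    let z≡ = map-tabulate-bvar ext (_↑ˡ toℕ i)
        ν≡ = map-tabulate-bvar ext (arity R ↑ʳ_)
    in cong₂ _⇒_ (cong (atom _) (map-++₂ ext z≡ ν≡))
      (rename-map-⇒*
        (λ c → atom (K r (suc (toℕ i)) (toℕ<n i))
                 (tabulate (λ j → bvar (j ↑ˡ toℕ i)) ++ᵛ
                  (tabulate (λ j → bvar (arity R ↑ʳ j)) ∷ʳ constant _ c))
               ⇒ prop (K̄ r (suc (toℕ i)) (toℕ<n i)))
        (λ c → cong (λ v → atom _ v ⇒ prop _)
          (map-++₂ ext z≡ (trans (map-∷ʳ η _ _) (cong₂ _∷ʳ_ ν≡ (free ext c)))))
        refl (allFin _))

  schema10 : ∀ {R} (r : Rule R) b →
             Schema (axiom10 r b) _ (λ θ → ax10 r (args (head r θ)) (yᵍ r θ) (ground P θ b))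
  schema10 r (Q ⟨ v ⟩) = schema λ {θ} {η} ext →
    let u≡ = map-⟦⟧* ext (mapᵛ (weakenTerm (|y| r)) (Clause.u (rule r)))
        v≡ = map-⟦⟧* ext v
    in cong₂ _⇒_ (cong (atom _) (map-++₂ ext u≡ (map-tabulate-bvar ext (Clause.nx (rule r) ↑ʳ_))))
      (cong₂ (λ w w′ → (atom _ w ⇒ atom (pair _ Q) w′ ⇒ prop ∘′) ⇒ prop _) v≡ (map-++₂ ext u≡ v≡))

  schema11 : ∀ {R} (r : Rule R) b →
             Schema (axiom11 r b) _ (λ θ → ax11 r (args (head r θ)) (yᵍ r θ) (ground P θ b))
  schema11 r (Q ⟨ v ⟩) = schema λ {θ} {η} ext →
    cong₂ _⇒_
      (cong (atom _) (map-++₂ ext (map-⟦⟧* ext _) (map-tabulate-bvar ext (Clause.nx (rule r) ↑ʳ_))))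
      (cong (λ w → atom (pos Q) w ⇒ prop _) (map-⟦⟧* ext v))

  schema12 : ∀ R Q S → Schema (axiom12 R Q S) (arity R + (arity Q + arity S)) (λ θ →
             ax12 (R ⟨ tabulate (λ j → θ (j ↑ˡ (arity Q + arity S))) ⟩)
                  (Q ⟨ tabulate (λ j → θ (arity R ↑ʳ (j ↑ˡ arity S))) ⟩)
                  (S ⟨ tabulate (λ j → θ (arity R ↑ʳ (arity Q ↑ʳ j))) ⟩))
  schema12 R Q S = schema λ {θ} {η} ext →
    let z≡ = map-tabulate-bvar ext (_↑ˡ (arity Q + arity S))
        y≡ = map-tabulate-bvar ext (λ j → arity R ↑ʳ (j ↑ˡ arity S))
        w≡ = map-tabulate-bvar ext (λ j → arity R ↑ʳ (arity Q ↑ʳ j))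
    in cong₂ _⇒_ (cong (atom _) (map-++₂ ext z≡ y≡))
         (cong₂ _⇒_ (cong (atom _) (map-++₂ ext y≡ w≡))
           (cong (λ v → (atom _ v ⇒ prop ∘′) ⇒ prop ∘′) (map-++₂ ext z≡ w≡)))

  schema13 : ∀ Q → Schema (axiom13 Q) (arity Q) (λ θ → ax13 (Q ⟨ tabulate θ ⟩))
  schema13 Q = schema λ ext →
    cong (λ v → atom (pair Q Q) v ⇒ prop ∘′) (map-++₂ ext (map-bvars ext) (map-bvars ext))

-- Auxiliary facts on lists and vectors

All-when : ∀ {X Y : Set} {Q : Y → Set} (d : Dec X) {f : X → List Y} →
           (∀ x → All Q (f x)) → All Q (when d f)
All-when (yes x) h = h x
All-when (no _)  h = []

All-concatMap : ∀ {X Y : Set} {Q : Y → Set} {f : X → List Y} xs →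
                (∀ x → All Q (f x)) → All Q (concatMap f xs)
All-concatMap xs h = Allₚ.concat⁺ (Allₚ.map⁺ (All.universal h xs))

take-++ : ∀ {X : Set} {m n} (xs : Vec X m) (ys : Vec X n) → take m (xs ++ᵛ ys) ≡ xs
take-++ []       ys = refl
take-++ (x ∷ xs) ys = cong (x ∷_) (take-++ xs ys)

drop-++ : ∀ {X : Set} {m n} (xs : Vec X m) (ys : Vec X n) → drop m (xs ++ᵛ ys) ≡ ys
drop-++ []       ys = refl
drop-++ (x ∷ xs) ys = drop-++ xs ys

lookup-fill : ∀ {X : Set} {l} (p : Fin l) {x : X} zs → lookup (fill p x zs) p ≡ x
lookup-fill {l = suc _} p zs = insertAt-lookup zs p _

lookup-fill₂ˡ : ∀ {X : Set} {l} (p q : Fin l) (p<q : p < q) {x y : X} zs →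
                lookup (fill₂ p q p<q x y zs) p ≡ x
lookup-fill₂ˡ {l = suc _} p q p<q zs = insertAt-lookup (fill _ _ zs) p _

lookup-fill₂ʳ : ∀ {X : Set} {l} (p q : Fin l) (p<q : p < q) {x y : X} zs →
                lookup (fill₂ p q p<q x y zs) q ≡ y
lookup-fill₂ʳ {l = suc _} p q p<q {x} {y} zs =
  trans (cong (lookup (insertAt inner p x)) (sym (punchIn-punchOut p≢q)))
    (trans (insertAt-punchIn inner p x (punchOut p≢q)) (lookup-fill (punchOut p≢q) zs))
  where
  p≢q = <⇒≢ p<q
  inner = fill (punchOut p≢q) y zs

-- Rule heads under valuations

module Matching (P : Program) where
  open Program P
  open Encoding P hiding (φ)
  open Ground P
  open Atom

  groundTerm-cong : ∀ {n} {θ τ : Fin n → Const} → θ ≗ τ → groundTerm P θ ≗ groundTerm P τ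
  groundTerm-cong eq (con c) = refl
  groundTerm-cong eq (var i) = eq i

  ground-cong : ∀ {n} {θ τ : Fin n → Const} → θ ≗ τ → ground P θ ≗ ground P τ
  ground-cong eq (Q ⟨ v ⟩) = cong (Q ⟨_⟩) (map-cong (groundTerm-cong eq) v)

  module _ {R} (r : Rule R) where
    open Clause (rule r)

    lookup-head : ∀ θ p → lookup (args (head r θ)) p ≡ groundTerm P (θ ∘ (_↑ˡ ny)) (lookup u p)
    lookup-head θ p =
      trans (lookup-map p (groundTerm P θ) (mapᵛ (weakenTerm ny) u))
        (trans (cong (groundTerm P θ) (lookup-map p (weakenTerm ny) u))
               (ground-weaken (lookup u p)))
      where
      ground-weaken : ∀ t → groundTerm P θ (weakenTerm ny t) ≡ groundTerm P (θ ∘ (_↑ˡ ny)) t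
      ground-weaken (con c) = refl
      ground-weaken (var i) = refl

    occurrence : ∀ i → ∃ λ p → lookup u p ≡ var i
    occurrence i = Anyᵛ.index (x-occurs i) , sym (Anyᵛₚ.lookup-index (x-occurs i))

    lookup-head-var : ∀ θ {p i} → lookup u p ≡ var i → lookup (args (head r θ)) p ≡ θ (i ↑ˡ ny)
    lookup-head-var θ {p} eq = trans (lookup-head θ p) (cong (groundTerm P _) eq)

    -- By `x-occurs` every variable of x⃗ occurs in the head, so the head arguments determine the
    -- values on x⃗.
    head-y-injective : ∀ {θ τ} → args (head r θ) ≡ args (head r τ) →
                       (∀ j → θ (nx ↑ʳ j) ≡ τ (nx ↑ʳ j)) → θ ≗ τ
    head-y-injective {θ} {τ} eq-x eq-y i =
      subst (λ i → θ i ≡ τ i) (join-splitAt nx ny i) (on-join (splitAt nx i))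
      where
      on-join : ∀ s → θ (join nx ny s) ≡ τ (join nx ny s)
      on-join (inj₁ i) = let p , u[p]≡i = occurrence i in
        trans (sym (lookup-head-var θ u[p]≡i))
          (trans (cong (λ v → lookup v p) eq-x) (lookup-head-var τ u[p]≡i))
      on-join (inj₂ j) = eq-y j

-- From provability to entailment

module Countermodel (P : Program) (M : Model P) (stable : Stable P M) where
  open Program P
  open Encoding P hiding (φ)
  open Ground P
  open Matching P
  open Atom
  open Equivalence

  infix 4 _∈M _≺_

  _∈M : GroundAtom P → Set
  a ∈M = T (M a)

  -- The stages of the fixed-point iteration: derivability by a tree of height at most `n`.
  Derived : ℕ → GroundAtom P → Set
  Derived zero    a = ⊥
  Derived (suc n) a = ∃ λ as → Reduct P M a as × All (Derived n) as

  Derived-mono : ∀ {m n a} → m ≤ n → Derived m a → Derived n a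
  Derived-mono (s≤s m≤n) (as , red , ds) = as , red , All.map (Derived-mono m≤n) ds

  I⇒Derived : ∀ {a} → I P M a → ∃ λ n → Derived n a
  I⇒Derived* : ∀ {as} → All (I P M) as → ∃ λ n → All (Derived n) as
  I⇒Derived (derive red is) = let n , ds = I⇒Derived* is in suc n , _ , red , ds
  I⇒Derived* []       = 0 , []
  I⇒Derived* (i ∷ is) =
    let m , d = I⇒Derived i ; n , ds = I⇒Derived* is
    in m ⊔ n , Derived-mono (m≤m⊔n m n) d ∷ All.map (Derived-mono (m≤n⊔m m n)) ds

  Derived⇒I : ∀ n {a} → Derived n a → I P M a
  Derived⇒I (suc n) (as , red , ds) = derive red (All.map (Derived⇒I n) ds)

  -- A stage separating the two atoms stands in for a comparison of least heights; it also covers an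
  -- `a` that is never derived.
  _≺_ : GroundAtom P → GroundAtom P → Set
  b ≺ a = ∃ λ n → Derived n b × ¬ Derived n a

  ≺-irrefl : ∀ {a} → ¬ a ≺ a
  ≺-irrefl (n , d , ¬d) = ¬d d

  -- If `m ≤ n`, then `b`, present at stage `m`, would be present at stage `n`, against the second
  -- hypothesis. Hence `n ≤ m`, and stage `m` separates `c` from `a`.
  ≺-trans : ∀ {a b c} → b ≺ a → c ≺ b → c ≺ a
  ≺-trans (m , db , ¬da) (n , dc , ¬db) with ≤-total m n
  ... | inj₁ m≤n = ⊥-elim (¬db (Derived-mono m≤n db))
  ... | inj₂ n≤m = m , Derived-mono n≤m dc , ¬da

  record Supports {R} (r : Rule R) (i : ℕ) (z : Vec Const (arity R)) (ν : Vec Const i) : Set where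
    open Clause (rule r)
    field
      valuation : Fin (nx + ny) → Const
      head≡     : z ≡ args (head r valuation)
      -- Positions in `ν` and in y⃗ have different types and are matched by their numerical values.
      prefix    : ∀ j j′ → toℕ j ≡ toℕ j′ → lookup ν j ≡ valuation (nx ↑ʳ j′)
      positives : All (λ b → ground P valuation b ∈M × ground P valuation b ≺ R ⟨ z ⟩) positive
      negatives : All (λ b → ¬ ground P valuation b ∈M) negative

  ⟪_⟫ : ∀ {k} → Symbol k → Vec Const k → Set
  ⟪ pos R ⟫    v = R ⟨ v ⟩ ∈M
  ⟪ bar R ⟫    v = ¬ R ⟨ v ⟩ ∈M
  ⟪ bang R ⟫   v = ¬ R ⟨ v ⟩ ∈M
  ⟪ query R ⟫  v = R ⟨ v ⟩ ∈M
  ⟪ pair R Q ⟫ v = Q ⟨ drop (arity R) v ⟩ ≺ R ⟨ take (arity R) v ⟩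
  ⟪ K {R} r i _ ⟫ v = Supports r i (take (arity R) v) (drop (arity R) v)
  ⟪ K̄ r i _ ⟫  v = ⊥
  ⟪ loop ⟫     v = ⊥
  ⟪ A ⟫        v = ⊥
  ⟪ B ⟫        v = ⊥
  ⟪ ∘′ ⟫       v = ⊥
  ⟪ •′ ⟫       v = ⊥

  open Tarski ⟪_⟫

  -- The domain consists of the free variables themselves, so `id` is the environment that
  -- interprets each constant by itself.
  at⁺ : ∀ {k} (s : Symbol k) {v} → ⟪ s ⟫ v → id ⊨ atom s v
  at⁺ s = subst ⟪ s ⟫ (sym (map-id _))

  at⁻ : ∀ {k} (s : Symbol k) {v} → id ⊨ atom s v → ⟪ s ⟫ v
  at⁻ s = subst ⟪ s ⟫ (map-id _)

  pair⁺ : ∀ {a b} → b ≺ a → id ⊨ pairᵃ a b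
  pair⁺ {R ⟨ z ⟩} {Q ⟨ w ⟩} b≺a =
    at⁺ (pair R Q) (subst₂ (λ z w → Q ⟨ w ⟩ ≺ R ⟨ z ⟩) (sym (take-++ z w)) (sym (drop-++ z w)) b≺a)

  pair⁻ : ∀ {a b} → id ⊨ pairᵃ a b → b ≺ a
  pair⁻ {R ⟨ z ⟩} {Q ⟨ w ⟩} b≺a =
    subst₂ (λ z w → Q ⟨ w ⟩ ≺ R ⟨ z ⟩) (take-++ z w) (drop-++ z w) (at⁻ (pair R Q) b≺a)

  K⁺ : ∀ {R} {r : Rule R} {i} .(i≤ : i ≤ |y| r) z ν →
       Supports r i z ν → id ⊨ atom (K r i i≤) (z ++ᵛ ν)
  K⁺ {r = r} {i} i≤ z ν s =
    at⁺ (K r i i≤) (subst₂ (Supports r i) (sym (take-++ z ν)) (sym (drop-++ z ν)) s)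

  K⁻ : ∀ {R} {r : Rule R} {i} .(i≤ : i ≤ |y| r) z ν →
       id ⊨ atom (K r i i≤) (z ++ᵛ ν) → Supports r i z ν
  K⁻ {r = r} {i} i≤ z ν s = subst₂ (Supports r i) (take-++ z ν) (drop-++ z ν) (at⁻ (K r i i≤) s)

  -- As `•` is false, a premise `P! → •` is a double negation of membership, removed because `M` is
  -- decidable. If all body literals hold, the instance derives its head in `I P M`, hence puts it
  -- in `M` by stability.
  valid5 : ∀ {R} (r : Rule R) θ → id ⊨ ax5 r θ
  valid5 {R} r θ head∉M = ⊨-⇒*⁺ _ λ ps → ⊨-⇒*⁺ _ λ ns →
    at⁻ (bang R) head∉M (from (stable _) (derive
      (reduct r θ (Allₚ.map⁺ (All.map (at⁻ (bar _)) (Allₚ.map⁻ ns))))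
      (Allₚ.map⁺ (All.map (λ ¬¬b → to (stable _) (decidable-stable (T? _) (¬¬b ∘ at⁺ (bang _))))
                          (Allₚ.map⁻ ps)))))

  -- Under a double negation the derivation height may be taken minimal, so that
  -- the body of the last rule used precedes its head.
  valid6 : ∀ a → id ⊨ ax6 a
  valid6 (R ⟨ z ⟩) z∈M = ⊨-⇒*⁺ _ λ rejects →
    let n , d = I⇒Derived (to (stable (R ⟨ z ⟩)) (at⁻ (query R) z∈M))
    in refute n d (λ r s → All.lookup (Allₚ.map⁻ rejects) (∈-allFin r) (K⁺ z≤n z [] s))
    where
    refute : ∀ n {z} → Derived n (R ⟨ z ⟩) → (∀ r → ¬ Supports r 0 z []) → ⊥
    refute (suc n) (_ , reduct r θ negs , ds) unsupported = unsupported r record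
      { valuation = θ
      ; head≡     = refl
      ; prefix    = λ ()
      ; positives = All.map
          (λ d → from (stable _) (Derived⇒I n d) , n , d , λ d′ → refute n d′ unsupported)
          (Allₚ.map⁻ ds)
      ; negatives = Allₚ.map⁻ negs
      }

  reject⁺ : ∀ {R} {r : Rule R} z → (∀ θ → z ≢ args (head r θ)) → id ⊨ reject r z
  reject⁺ z z≢head k = z≢head (Supports.valuation s) (Supports.head≡ s)
    where s = K⁻ z≤n z [] k

  valid7 : ∀ {R} (r : Rule R) p {c d} zs → lookup (Clause.u (rule r)) p ≡ con c → d ≢ c →
           id ⊨ reject r (fill p d zs)
  valid7 r p zs u[p]≡c d≢c = reject⁺ _ λ θ eq →
    d≢c (trans (sym (lookup-fill p zs))
          (trans (cong (λ v → lookup v p) eq)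
            (trans (lookup-head r θ p) (cong (groundTerm P _) u[p]≡c))))

  valid8 : ∀ {R} (r : Rule R) p q p<q {c d i} zs → let open Clause (rule r) in
           lookup u p ≡ var i → lookup u q ≡ var i → c ≢ d →
           id ⊨ reject r (fill₂ p q p<q c d zs)
  valid8 r p q p<q zs u[p]≡i u[q]≡i c≢d = reject⁺ _ λ θ eq →
    c≢d (trans (sym (lookup-fill₂ˡ p q p<q zs))
          (trans (cong (λ v → lookup v p) eq)
            (trans (lookup-head-var r θ u[p]≡i)
              (trans (sym (lookup-head-var r θ u[q]≡i))
                (trans (cong (λ v → lookup v q) (sym eq)) (lookup-fill₂ʳ p q p<q zs))))))

  valid9 : ∀ {R} (r : Rule R) i z ν → id ⊨ ax9 r i z ν
  valid9 r i z ν k = ⊨-⇒*⁺ _ λ rejects →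
    -- The constant to append is the value that the supporting valuation gives to the next variable
    -- of y⃗.
    All.lookup (Allₚ.map⁻ rejects) (∈-allFin (θ (nx ↑ʳ i))) (K⁺ (toℕ<n i) z (ν ∷ʳ _) record
      { valuation = θ
      ; head≡     = Supports.head≡ s
      ; prefix    = λ j j′ → snoc j (view j) j′
      ; positives = Supports.positives s
      ; negatives = Supports.negatives s
      })
    where
    open Clause (rule r)
    s = K⁻ (<⇒≤ (toℕ<n i)) z ν k
    θ = Supports.valuation s
    lookup-∷ʳ-inject₁ : ∀ {m} (xs : Vec Const m) x j → lookup (xs ∷ʳ x) (inject₁ j) ≡ lookup xs j
    lookup-∷ʳ-inject₁ (_ ∷ xs) x zero    = refl
    lookup-∷ʳ-inject₁ (_ ∷ xs) x (suc j) = lookup-∷ʳ-inject₁ xs x j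
    lookup-∷ʳ-fromℕ : ∀ {m} (xs : Vec Const m) x → lookup (xs ∷ʳ x) (fromℕ m) ≡ x
    lookup-∷ʳ-fromℕ []       x = refl
    lookup-∷ʳ-fromℕ (_ ∷ xs) x = lookup-∷ʳ-fromℕ xs x
    snoc : ∀ j → View j → ∀ j′ → toℕ j ≡ toℕ j′ →
           lookup (ν ∷ʳ θ (nx ↑ʳ i)) j ≡ θ (nx ↑ʳ j′)
    snoc _ ‵fromℕ j′ eq =
      trans (lookup-∷ʳ-fromℕ ν _)
        (cong (θ ∘ (nx ↑ʳ_)) (toℕ-injective (trans (sym (toℕ-fromℕ (toℕ i))) eq)))
    snoc _ (‵inject₁ j) j′ eq =
      trans (lookup-∷ʳ-inject₁ ν _ j) (Supports.prefix s j j′ (trans (sym (toℕ-inject₁ j)) eq))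

  module _ {R} (r : Rule R) (θ : _) (s : Supports r (|y| r) (args (head r θ)) (yᵍ r θ)) where
    open Clause (rule r)

    -- The head fixes the values on x⃗ and a prefix of full length those on y⃗, so the support
    -- concerns the very instance given by `θ`.
    support-unique : Supports.valuation s ≗ θ
    support-unique = head-y-injective r (sym (Supports.head≡ s)) λ j →
      trans (sym (Supports.prefix s j j refl)) (lookup∘tabulate _ j)

    full-positives : All (λ b → ground P θ b ∈M × ground P θ b ≺ head r θ) positive
    full-positives = All.map
      (λ {b} → subst (λ b → b ∈M × b ≺ head r θ) (ground-cong support-unique b))
      (Supports.positives s)

    full-negatives : All (λ b → ¬ ground P θ b ∈M) negative
    full-negatives = All.map (λ {b} → subst (λ b → ¬ b ∈M) (ground-cong support-unique b))
      (Supports.negatives s)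

  valid10 : ∀ {R} (r : Rule R) →
            All (λ b → ∀ θ → id ⊨ ax10 r (args (head r θ)) (yᵍ r θ) (ground P θ b))
                (Clause.positive (rule r))
  valid10 r = All.tabulate λ b∈ θ k f →
    let b∈M , b≺ = All.lookup (full-positives r θ (K⁻ ≤-refl (args (head r θ)) (yᵍ r θ) k)) b∈
    in f (at⁺ (query _) b∈M) (pair⁺ b≺)

  valid11 : ∀ {R} (r : Rule R) →
            All (λ b → ∀ θ → id ⊨ ax11 r (args (head r θ)) (yᵍ r θ) (ground P θ b))
                (Clause.negative (rule r))
  valid11 r = All.tabulate λ b∈ θ k b∈M →
    All.lookup (full-negatives r θ (K⁻ ≤-refl (args (head r θ)) (yᵍ r θ) k)) b∈ (at⁻ (pos _) b∈M)

  valid12 : ∀ a b c → id ⊨ ax12 a b c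
  valid12 a b c ab bc f = f (pair⁺ {a} {c} (≺-trans (pair⁻ {a} {b} ab) (pair⁻ {b} {c} bc)))

  -- An environment for the bound variables is at the same time a substitution into the free
  -- variables, so truth of the matrix under it amounts to truth of a ground instance under `id`.
  schema-valid : ∀ {k A G} → Schema A k G → (∀ θ → id ⊨ G θ) → id ⊨ A
  schema-valid {k} (schema {A = C} eq) f = ⊨-∀* k λ η free →
    ⊨-rename⁻ {ρ = id} (λ _ → refl) C
      (subst (id ⊨_) (sym (eq record { bound = λ _ → refl ; free = free })) (f (η ∘ bvar)))

  valid-axioms7At : ∀ {R} (r : Rule R) p t → lookup (Clause.u (rule r)) p ≡ t →
                    All (id ⊨_) (axioms7At r p t)
  valid-axioms7At r p (var i) eq = []
  valid-axioms7At r p (con c) eq = All-concatMap (allFin _) λ d → All-when (¬? (d ≟ c)) λ d≢c →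
    schema-valid (schema7 r p d) (λ θ → valid7 r p (tabulate θ) eq d≢c) ∷ []

  valid-axioms8At : ∀ {R} (r : Rule R) p q p<q t t′ → let open Clause (rule r) in
                    lookup u p ≡ t → lookup u q ≡ t′ → All (id ⊨_) (axioms8At r p q p<q t t′)
  valid-axioms8At r p q p<q (con _) _       eq eq′ = []
  valid-axioms8At r p q p<q (var _) (con _) eq eq′ = []
  valid-axioms8At r p q p<q (var i) (var j) eq eq′ = All-when (i ≟ j) λ { refl →
    All-concatMap (allFin _) λ c → All-concatMap (allFin _) λ d → All-when (¬? (c ≟ d)) λ c≢d →
      schema-valid (schema8 r p q p<q c d) (λ θ → valid8 r p q p<q (tabulate θ) eq eq′ c≢d) ∷ [] }

  All-forPreds : ∀ {Q : Fml #const → Set} {f} → (∀ R → All Q (f R)) → All Q (forPreds f)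
  All-forPreds = All-concatMap (allFin #pred)

  All-forRules : ∀ {Q : Fml #const → Set} {f : ∀ {R} → Rule R → List (Fml #const)} →
                 (∀ {R} (r : Rule R) → All Q (f r)) → All Q (forRules f)
  All-forRules h = All-forPreds λ R → All-concatMap (allFin _) (h {R})

  valid-axioms : ∀ {Ω} → ¬ Ω ∈M → All (id ⊨_) (axioms Ω)
  valid-axioms {R ⟨ v ⟩} Ω∉M =
    Allₚ.++⁺ (All-forPreds λ R → schema-valid (schema1 R) (λ _ f g → g f) ∷ [])
    -- The first axiom of group (2) is where the assumption that `Ω` lies outside `M` enters.
    (Allₚ.++⁺ (Ω∉M ∘ at⁻ (pos R) ∷ id ∷ id ∷ [])
    (Allₚ.++⁺ (All-forPreds λ R → schema-valid (schema3 R) (λ _ n f → f n) ∷ [])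
    (Allₚ.++⁺ (All-forPreds λ R → schema-valid (schema4 R) (λ _ p f → f p) ∷ [])
    (Allₚ.++⁺ (All-forRules λ r → schema-valid (schema5 r) (valid5 r) ∷ [])
    (Allₚ.++⁺ (All-forPreds λ R → schema-valid (schema6 R) (λ θ → valid6 (R ⟨ tabulate θ ⟩)) ∷ [])
    (Allₚ.++⁺ (All-forRules λ r → All-concatMap (allFin _) λ p → valid-axioms7At r p _ refl)
    (Allₚ.++⁺ (All-forRules λ r → All-concatMap (allFin _) λ p → All-concatMap (allFin _) λ q →
                 All-when (p <? q) λ p<q → valid-axioms8At r p q p<q _ _ refl refl)
    (Allₚ.++⁺ (All-forRules λ r → Allₚ.map⁺ (All.universal (λ i →
                 schema-valid (schema9 r i)
                   (λ θ → valid9 r i (tabulate (θ ∘ (_↑ˡ toℕ i))) (tabulate (θ ∘ (_ ↑ʳ_))))) _))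
    (Allₚ.++⁺ (All-forRules λ r → Allₚ.map⁺ (
                 All.map (λ {b} → schema-valid (schema10 r b)) (valid10 r)))
    (Allₚ.++⁺ (All-forRules λ r → Allₚ.map⁺ (
                 All.map (λ {b} → schema-valid (schema11 r b)) (valid11 r)))
    (Allₚ.++⁺ (All-forPreds λ R → All-forPreds λ Q → All-forPreds λ S →
                 schema-valid (schema12 R Q S) (λ _ →
                   valid12 (R ⟨ tabulate _ ⟩) (Q ⟨ tabulate _ ⟩) (S ⟨ tabulate _ ⟩)) ∷ [])
    (All-forPreds λ Q → schema-valid (schema13 Q)
       (λ θ → ≺-irrefl {Q ⟨ tabulate θ ⟩} ∘ pair⁻ {Q ⟨ _ ⟩} {Q ⟨ _ ⟩}) ∷ []))))))))))))

  -- `M` is decidable, so it suffices to refute that it omits `Ω`: then all axioms would be true,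
  -- and by soundness so would `loop`, which is false.
  provable⇒member : ∀ Ω → [] ⊢ φ P Ω → Ω ∈M
  provable⇒member Ω d = decidable-stable (T? _) λ Ω∉M →
    ⊨-⇒*⁻ (sound d {id} []) (valid-axioms Ω∉M)

-- From entailment to provability

∈-when : ∀ {X Y : Set} (d : Dec X) {f : X → List Y} {y} → X → (∀ x → y ∈ f x) → y ∈ when d f
∈-when (yes x) _ y∈f = y∈f x
∈-when (no ¬x) x y∈f = contradiction x ¬x

-- `B` does not mention `x`, so a single failing element settles the alternative. This replaces
-- excluded middle in the finite case distinctions below.
decide-all : ∀ {X B : Set} {Q : X → Set} → (∀ x → Q x ⊎ B) → ∀ xs → All Q xs ⊎ B
decide-all f xs = Sum.map₂ (proj₂ ∘ Any.satisfied) (All.decide f xs)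

decide-Fin : ∀ {n} {B : Set} {Q : Fin n → Set} → (∀ i → Q i ⊎ B) → (∀ i → Q i) ⊎ B
decide-Fin f = Sum.map₁ (λ qs i → All.lookup qs (∈-allFin i)) (decide-all f (allFin _))

-- Supplies the descent of `search`: the list of unvisited atoms loses one entry, and whatever drops
-- out equals `x`.
remove : ∀ {X : Set} {x : X} {xs} → x ∈ xs →
         ∃ λ ys → length xs ≡ suc (length ys) × (∀ {y} → y ∈ xs → y ≡ x ⊎ y ∈ ys)
remove {xs = x ∷ xs} (here refl) = xs , refl , λ { (here eq) → inj₁ eq ; (there y∈) → inj₂ y∈ }
remove {xs = x ∷ xs} (there x∈xs) =
  let ys , len , split = remove x∈xs
  in x ∷ ys , cong suc len ,
     λ { (here eq) → inj₂ (here eq) ; (there y∈) → Sum.map₂ there (split y∈) }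

lookup-ext : ∀ {X : Set} {n} {v w : Vec X n} → lookup v ≗ lookup w → v ≡ w
lookup-ext {v = v} {w} eq =
  trans (sym (tabulate∘lookup v)) (trans (tabulate-cong eq) (tabulate∘lookup w))

tabulate-++ˡ : ∀ {X : Set} {m n} (v : Vec X m) (w : Vec X n) →
               tabulate (lookup (v ++ᵛ w) ∘ (_↑ˡ n)) ≡ v
tabulate-++ˡ v w = trans (tabulate-cong (lookup-++ˡ v w)) (tabulate∘lookup v)

tabulate-++ʳ : ∀ {X : Set} {m n} (v : Vec X m) (w : Vec X n) →
               tabulate (lookup (v ++ᵛ w) ∘ (m ↑ʳ_)) ≡ w
tabulate-++ʳ v w = trans (tabulate-cong (lookup-++ʳ v w)) (tabulate∘lookup w)

-- Axiom (7) speaks of tuples built by `fill`; this makes it applicable to any tuple with a wrong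
-- constant at `p`.
fill-surjective : ∀ {X : Set} {l} (p : Fin l) (z : Vec X l) → ∃ λ zs → fill p (lookup z p) zs ≡ z
fill-surjective {l = suc _} p z = removeAt z p , insertAt-removeAt z p

fill₂-surjective : ∀ {X : Set} {l} (p q : Fin l) (p<q : p < q) (z : Vec X l) →
                   ∃ λ zs → fill₂ p q p<q (lookup z p) (lookup z q) zs ≡ z
fill₂-surjective {l = suc _} p q p<q z =
  let zs , eq = fill-surjective (punchOut p≢q) (removeAt z p)
  in zs , trans (cong (fill p (lookup z p))
            (trans (cong (λ x → fill (punchOut p≢q) x zs) (sym (removeAt-punchOut z p≢q))) eq))
          (insertAt-removeAt z p)
  where p≢q = <⇒≢ p<q

-- Induction from `n` down to 0, as the chain of axioms (9) runs; `k` is the distance from `m` to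
-- `n`. The helper `at` takes the index `i` separately so that `toℕ i ≡ m` can be matched.
downward : ∀ {n} (Q : ∀ m → .(m ≤ n) → Set) →
           (∀ (i : Fin n) → Q (suc (toℕ i)) (toℕ<n i) → Q (toℕ i) (<⇒≤ (toℕ<n i))) →
           Q n ≤-refl → Q 0 z≤n
downward {n} Q step base = go n (+-identityʳ n) z≤n
  where
  go : ∀ k {m} → k + m ≡ n → .(m≤n : m ≤ n) → Q m m≤n
  at : ∀ k {m} → suc k + m ≡ n → .(m≤n : m ≤ n) → ∀ i → toℕ i ≡ m → Q m m≤n
  go zero        refl _  = base
  go (suc k) {m} eq   le = at k eq le (fromℕ< m<n) (toℕ-fromℕ< m<n)
    where
    m<n : suc m ≤ n
    m<n = subst (suc m ≤_) eq (s≤s (m≤n+m m k))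
  at k eq _ i refl = step i (go k (trans (+-suc k (toℕ i)) eq) (toℕ<n i))

-- Ends with the last block itself rather than with `[]`, so that it unfolds to the right-nested
-- `_++_` of `axioms`.
join⁺ : ∀ {X : Set} → List X → List (List X) → List X
join⁺ xs []         = xs
join⁺ xs (ys ∷ yss) = xs ++ join⁺ ys yss

∈-join⁺ : ∀ {X : Set} {x : X} ys yss k → x ∈ List.lookup (ys ∷ yss) k → x ∈ join⁺ ys yss
∈-join⁺ ys []         zero    x∈ = x∈
∈-join⁺ ys (zs ∷ yss) zero    x∈ = ∈-++⁺ˡ x∈
∈-join⁺ ys (zs ∷ yss) (suc k) x∈ = ∈-++⁺ʳ ys (∈-join⁺ zs yss k x∈)

-- Enumerating the ground atoms and deriving ground axioms

module Derivations (P : Program) (Ω : GroundAtom P) where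
  open Program P
  open Encoding P hiding (φ)
  open Ground P
  open Matching P
  open Atom

  allVec : ∀ n → List (Vec Const n)
  allVec zero    = [] ∷ []
  allVec (suc n) = cartesianProductWith _∷_ (allFin _) (allVec n)

  ∈-allVec : ∀ {n} (v : Vec Const n) → v ∈ allVec n
  ∈-allVec []      = here refl
  ∈-allVec (c ∷ v) = ∈-cartesianProductWith⁺ _∷_ (∈-allFin c) (∈-allVec v)

  atoms : List (GroundAtom P)
  atoms = concatMap (λ R → map (R ⟨_⟩) (allVec (arity R))) (allFin #pred)

  ∈-atoms : ∀ a → a ∈ atoms
  ∈-atoms (R ⟨ z ⟩) =
    ∈-concatMap⁺ (λ R → map (R ⟨_⟩) (allVec (arity R)))
      (lose (∈-allFin R) (∈-map⁺ (R ⟨_⟩) (∈-allVec z)))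

  ∈-forPreds : ∀ {f : Pred → List (Fml #const)} R {C} → C ∈ f R → C ∈ forPreds f
  ∈-forPreds {f} R C∈ = ∈-concatMap⁺ f (lose (∈-allFin R) C∈)

  ∈-forRules : ∀ (f : ∀ {R} → Rule R → List (Fml #const)) {R} (r : Rule R) {C} →
               C ∈ f r → C ∈ forRules f
  ∈-forRules f {R} r C∈ = ∈-forPreds R (∈-concatMap⁺ (f {R}) (lose (∈-allFin r) C∈))

  -- axioms Ω is definitionally join⁺ (forPreds λ R → [ axiom1 R ]) blocks.
  blocks : List (List (Fml #const))
  blocks =
      axioms2 Ω
    ∷ forPreds (λ R → [ axiom3 R ])
    ∷ forPreds (λ R → [ axiom4 R ])
    ∷ forRules (λ r → [ axiom5 r ])
    ∷ forPreds (λ R → [ axiom6 R ])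
    ∷ forRules (λ r → axioms7 r)
    ∷ forRules (λ r → axioms8 r)
    ∷ forRules (λ r → map (axiom9 r) (allFin (|y| r)))
    ∷ forRules (λ r → map (axiom10 r) (Clause.positive (rule r)))
    ∷ forRules (λ r → map (axiom11 r) (Clause.negative (rule r)))
    ∷ forPreds (λ R → forPreds λ Q → forPreds λ S → [ axiom12 R Q S ])
    ∷ forPreds (λ Q → [ axiom13 Q ])
    ∷ []

  module Axioms {Γ : List (Fml #const)} (axioms⊆Γ : axioms Ω ⊆ Γ) where

    instances : ∀ {k C} (G : Vec Const k → Fml #const) →
                Schema C k (λ θ → G (tabulate θ)) → C ∈ axioms Ω → ∀ z → Γ ⊢ G z
    instances G s C∈ z =
      subst (λ z → Γ ⊢ G z) (tabulate∘lookup z) (instance-⊢ s (axioms⊆Γ C∈) (lookup z))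

    ∈-axioms : ∀ k {C} → C ∈ List.lookup (forPreds (λ R → [ axiom1 R ]) ∷ blocks) k → C ∈ axioms Ω
    ∈-axioms k = ∈-join⁺ _ blocks k

    provable1 : ∀ a → Γ ⊢ ax1 a
    provable1 (R ⟨ z ⟩) = instances (λ z → ax1 (R ⟨ z ⟩)) (schema1 R)
      (∈-axioms (# 0) (∈-forPreds R (here refl))) z

    Ω⇒loop : Γ ⊢ posᵃ Ω ⇒ prop loop
    Ω⇒loop = hyp (axioms⊆Γ (∈-axioms (# 1) (here refl)))

    A⇒loop : Γ ⊢ prop A ⇒ prop loop
    A⇒loop = hyp (axioms⊆Γ (∈-axioms (# 1) (there (here refl))))

    B⇒loop : Γ ⊢ prop B ⇒ prop loop
    B⇒loop = hyp (axioms⊆Γ (∈-axioms (# 1) (there (there (here refl)))))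

    provable3 : ∀ a → Γ ⊢ ax3 a
    provable3 (R ⟨ z ⟩) = instances (λ z → ax3 (R ⟨ z ⟩)) (schema3 R)
      (∈-axioms (# 2) (∈-forPreds R (here refl))) z

    provable4 : ∀ a → Γ ⊢ ax4 a
    provable4 (R ⟨ z ⟩) = instances (λ z → ax4 (R ⟨ z ⟩)) (schema4 R)
      (∈-axioms (# 3) (∈-forPreds R (here refl))) z

    provable5 : ∀ {R} (r : Rule R) θ → Γ ⊢ ax5 r θ
    provable5 r = instance-⊢ (schema5 r)
      (axioms⊆Γ (∈-axioms (# 4) (∈-forRules (λ r → [ axiom5 r ]) r (here refl))))

    provable6 : ∀ a → Γ ⊢ ax6 a
    provable6 (R ⟨ z ⟩) = instances (λ z → ax6 (R ⟨ z ⟩)) (schema6 R)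
      (∈-axioms (# 5) (∈-forPreds R (here refl))) z

    provable7 : ∀ {R} (r : Rule R) p {c} z → lookup (Clause.u (rule r)) p ≡ con c → lookup z p ≢ c →
                Γ ⊢ reject r z
    provable7 r p {c} z u[p]≡c d≢c =
      let d = lookup z p ; zs , fill≡z = fill-surjective p z in
      subst (λ z → Γ ⊢ reject r z) fill≡z
        (instances (λ zs → reject r (fill p d zs)) (schema7 r p d)
          (∈-axioms (# 6) (∈-forRules axioms7 r
            (∈-concatMap⁺ (λ p → axioms7At r p (lookup (Clause.u (rule r)) p)) (lose (∈-allFin p)
              (subst (λ t → axiom7 r p d ∈ axioms7At r p t) (sym u[p]≡c)
                (∈-concatMap⁺ (λ d → when (¬? (d ≟ c)) λ _ → [ axiom7 r p d ]) (lose (∈-allFin d)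
                  (∈-when (¬? (d ≟ c)) d≢c λ _ → here refl))))))))
          zs)

    provable8 : ∀ {R} (r : Rule R) p q → p < q → ∀ {i} z → let open Clause (rule r) in
                lookup u p ≡ var i → lookup u q ≡ var i → lookup z p ≢ lookup z q →
                Γ ⊢ reject r z
    provable8 r p q p<q {i} z u[p]≡i u[q]≡i c≢d =
      let c = lookup z p ; d = lookup z q ; zs , fill≡z = fill₂-surjective p q p<q z in
      subst (λ z → Γ ⊢ reject r z) fill≡z
        (instances (λ zs → reject r (fill₂ p q p<q c d zs)) (schema8 r p q p<q c d)
          (∈-axioms (# 7) (∈-forRules axioms8 r
            (∈-concatMap⁺ (λ p → concatMap (at p) (allFin _)) (lose (∈-allFin p)
              (∈-concatMap⁺ (at p) (lose (∈-allFin q)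
                (∈-when (p <? q) p<q λ p<q′ →
                  -- `when` hands over the proof found by `p <? q`, which has to be identified with
                  -- the given one.
                  subst (λ lt → axiom8 r p q p<q c d ∈ axioms8At r p q lt (lookup u p) (lookup u q))
                    (<-irrelevant p<q p<q′)
                    (subst₂ (λ t t′ → axiom8 r p q p<q c d ∈ axioms8At r p q p<q t t′)
                      (sym u[p]≡i) (sym u[q]≡i)
                      (∈-when (i ≟ i) refl λ _ → ∈-distinct c≢d)))))))))
          zs)
      where
      open Clause (rule r)
      at : ∀ p q → List (Fml #const)
      at p q = when (p <? q) λ p<q → axioms8At r p q p<q (lookup u p) (lookup u q)
      row : Const → Const → List (Fml #const)
      row c d = when (¬? (c ≟ d)) λ _ → [ axiom8 r p q p<q c d ]
      ∈-distinct : ∀ {c d} → c ≢ d →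
                   axiom8 r p q p<q c d ∈ concatMap (λ c → concatMap (row c) (allFin _)) (allFin _)
      ∈-distinct {c} {d} c≢d =
        ∈-concatMap⁺ (λ c → concatMap (row c) (allFin _)) (lose (∈-allFin c)
          (∈-concatMap⁺ (row c) (lose (∈-allFin d) (∈-when (¬? (c ≟ d)) c≢d λ _ → here refl))))

    provable9 : ∀ {R} (r : Rule R) i z ν → Γ ⊢ ax9 r i z ν
    provable9 r i z ν =
      subst₂ (λ z ν → Γ ⊢ ax9 r i z ν) (tabulate-++ˡ z ν) (tabulate-++ʳ z ν)
        (instance-⊢ (schema9 r i)
          (axioms⊆Γ (∈-axioms (# 8) (∈-forRules (λ r → map (axiom9 r) (allFin (|y| r))) r
            (∈-map⁺ (axiom9 r) (∈-allFin i)))))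
          (lookup (z ++ᵛ ν)))

    provable10 : ∀ {R} (r : Rule R) {b} → b ∈ Clause.positive (rule r) → ∀ θ →
                 Γ ⊢ ax10 r (args (head r θ)) (yᵍ r θ) (ground P θ b)
    provable10 r b∈ = instance-⊢ (schema10 r _) (axioms⊆Γ (∈-axioms (# 9)
      (∈-forRules (λ r → map (axiom10 r) (Clause.positive (rule r))) r (∈-map⁺ (axiom10 r) b∈))))

    provable11 : ∀ {R} (r : Rule R) {b} → b ∈ Clause.negative (rule r) → ∀ θ →
                 Γ ⊢ ax11 r (args (head r θ)) (yᵍ r θ) (ground P θ b)
    provable11 r b∈ = instance-⊢ (schema11 r _) (axioms⊆Γ (∈-axioms (# 10)
      (∈-forRules (λ r → map (axiom11 r) (Clause.negative (rule r))) r (∈-map⁺ (axiom11 r) b∈))))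

    provable12 : ∀ a b c → Γ ⊢ ax12 a b c
    provable12 (R ⟨ z ⟩) (Q ⟨ y ⟩) (S ⟨ w ⟩) =
      transport (tabulate-++ˡ z (y ++ᵛ w))
        (trans (tabulate-cong (lookup-++ʳ z (y ++ᵛ w) ∘ (_↑ˡ _))) (tabulate-++ˡ y w))
        (trans (tabulate-cong (lookup-++ʳ z (y ++ᵛ w) ∘ (_ ↑ʳ_))) (tabulate-++ʳ y w))
        (instance-⊢ (schema12 R Q S)
          (axioms⊆Γ (∈-axioms (# 11) (∈-forPreds R (∈-forPreds Q (∈-forPreds S (here refl))))))
          (lookup (z ++ᵛ (y ++ᵛ w))))
      where
      transport : ∀ {z′ y′ w′} → z′ ≡ z → y′ ≡ y → w′ ≡ w →
                  Γ ⊢ ax12 (R ⟨ z′ ⟩) (Q ⟨ y′ ⟩) (S ⟨ w′ ⟩) → Γ ⊢ ax12 (R ⟨ z ⟩) (Q ⟨ y ⟩) (S ⟨ w ⟩)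
      transport refl refl refl d = d

    provable13 : ∀ a → Γ ⊢ ax13 a
    provable13 (Q ⟨ z ⟩) = instances (λ z → ax13 (Q ⟨ z ⟩)) (schema13 Q)
      (∈-axioms (# 12) (∈-forPreds Q (here refl))) z

-- Refutation search relative to a candidate model

module Search (P : Program) (Ω : GroundAtom P) (M : Model P) where
  open Program P
  open Encoding P hiding (φ)
  open Ground P
  open Matching P
  open Derivations P Ω
  open Atom

  module _ (Γ₀ : List (Fml #const)) (axioms⊆Γ₀ : axioms Ω ⊆ Γ₀)
           (literals : ∀ a → literal a (M a) ∈ Γ₀) where

    -- Makes the ground axioms available in every context extending `Γ₀`, with the inclusion as
    -- first explicit argument.
    open module Ax {Δ} (Γ₀⊆Δ : Γ₀ ⊆ Δ) = Axioms (λ C∈ → Γ₀⊆Δ (axioms⊆Γ₀ C∈))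

    pos∈ : ∀ {a} → T (M a) → posᵃ a ∈ Γ₀
    pos∈ {a} a∈M with true ← M a | lit∈ ← literals a = lit∈

    bar∈ : ∀ {a} → ¬ T (M a) → barᵃ a ∈ Γ₀
    bar∈ {a} a∉M with M a | literals a
    ... | true  | _    = contradiction _ a∉M
    ... | false | lit∈ = lit∈

    -- These hypotheses are the trace, inside the formal proof, of the search branch leading to `a`.
    After : List (GroundAtom P) → GroundAtom P → List (Fml #const) → Set
    After H a Δ = All (λ h → pairᵃ h a ∈ Δ) H

    Refutes : List (GroundAtom P) → GroundAtom P → Set
    Refutes H a = ∀ Δ → Γ₀ ⊆ Δ → After H a Δ → queryᵃ a ∈ Δ → Δ ⊢ prop ∘′

    -- Axiom (12), applied once for each `h` in `H`, composes the pair of `h` and `a` with that of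
    -- `a` and `b`. It offers the composite only as a hypothesis for deriving `∘`, hence the
    -- continuation `k`.
    after-step : ∀ H {Δ a b} → Γ₀ ⊆ Δ → After H a Δ → pairᵃ a b ∈ Δ →
                 (∀ Δ′ → Δ ⊆ Δ′ → After H b Δ′ → Δ′ ⊢ prop ∘′) → Δ ⊢ prop ∘′
    after-step []      Γ₀⊆Δ []         ab k = k _ id []
    after-step (h ∷ H) Γ₀⊆Δ (ha ∷ Ha) ab k =
      ⇒E (⇒E (⇒E (provable12 Γ₀⊆Δ h _ _) (hyp ha)) (hyp ab))
        (⇒I (after-step H (there ∘ Γ₀⊆Δ) (All.map there Ha) (there ab) λ Δ′ ⊆Δ′ Hb →
          k Δ′ (⊆Δ′ ∘ there) (⊆Δ′ (here refl) ∷ Hb)))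

    module _ {R} (r : Rule R) (z : Vec Const (arity R)) where
      open Clause (rule r)

      Rejects : Set
      Rejects = ∀ Δ → Γ₀ ⊆ Δ → Δ ⊢ reject r z

      match-con : ∀ p → (∀ c → lookup u p ≡ con c → lookup z p ≡ c) ⊎ Rejects
      match-con p with lookup u p in u[p]≡
      ... | var i = inj₁ λ _ ()
      ... | con c with lookup z p ≟ c
      ...   | yes eq = inj₁ λ { _ refl → eq }
      ...   | no neq = inj₂ λ Δ Γ₀⊆Δ → provable7 Γ₀⊆Δ r p z u[p]≡ neq

      SameValue : Fin (arity R) → Fin (arity R) → Set
      SameValue p q = ∀ i → lookup u p ≡ var i → lookup u q ≡ var i → lookup z p ≡ lookup z q

      match-var< : ∀ p q → p < q → SameValue p q ⊎ Rejects
      match-var< p q p<q with lookup u p in u[p]≡ | lookup u q in u[q]≡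
      ... | con _ | _     = inj₁ λ _ ()
      ... | var _ | con _ = inj₁ λ _ _ ()
      ... | var i | var j with i ≟ j
      ...   | no i≢j = inj₁ λ { _ refl refl → contradiction refl i≢j }
      ...   | yes refl with lookup z p ≟ lookup z q
      ...     | yes eq = inj₁ λ _ _ _ → eq
      ...     | no neq = inj₂ λ Δ Γ₀⊆Δ → provable8 Γ₀⊆Δ r p q p<q z u[p]≡ u[q]≡ neq

      match-var : ∀ p q → SameValue p q ⊎ Rejects
      match-var p q with <-cmp p q
      ... | tri< p<q _ _  = match-var< p q p<q
      ... | tri≈ _ refl _ = inj₁ λ _ _ _ → refl
      ... | tri> _ _ q<p  = Sum.map₁ (λ f i u[p]≡ u[q]≡ → sym (f i u[q]≡ u[p]≡))
                                    (match-var< q p q<p)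

      -- One-sided matching of `u` against the ground tuple `z`: a clash with a constant is rejected
      -- by (7), two values for one variable by (8).
      match : (∃ λ θ → ∀ p → lookup z p ≡ groundTerm P θ (lookup u p)) ⊎ Rejects
      match with decide-Fin match-con | decide-Fin (λ p → decide-Fin (match-var p))
      ... | inj₂ rej | _        = inj₂ rej
      ... | inj₁ _   | inj₂ rej = inj₂ rej
      ... | inj₁ on-con | inj₁ on-var = inj₁ (θ , agree)
        where
        θ : Fin nx → Const
        -- The value is read off at one recorded occurrence; `on-var` makes the other occurrences
        -- agree.
        θ i = lookup z (proj₁ (occurrence r i))
        agree : ∀ p → lookup z p ≡ groundTerm P θ (lookup u p)
        agree p with lookup u p in u[p]≡
        ... | con c = on-con p c u[p]≡
        ... | var i = on-var p _ i u[p]≡ (proj₂ (occurrence r i))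

    module _ {R} (r : Rule R) (H : List (GroundAtom P)) where
      open Clause (rule r)

      Unsupported : (m : ℕ) .(m≤ : m ≤ ny) → Vec Const (arity R) → Vec Const m → Set
      Unsupported m m≤ z ν = ∀ Δ → Γ₀ ⊆ Δ → After H (R ⟨ z ⟩) Δ →
        atom (K r m m≤) (z ++ᵛ ν) ∈ Δ → Δ ⊢ prop (K̄ r m m≤)

      -- A refuted positive atom gives `K̄` by (10), and a negated atom that belongs to `M` gives it
      -- by (11). Otherwise the instance survives in the reduct and derives its head.
      decide-instance : ∀ θ → (∀ b → I P M b ⊎ Refutes (head r θ ∷ H) b) →
                        I P M (head r θ) ⊎ Unsupported ny ≤-refl (args (head r θ)) (yᵍ r θ)
      decide-instance θ decide-body with All.decide (decide-body ∘ ground P θ) positive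
      ... | inj₂ some = let b , b∈ , refutes = find some in inj₂ λ Δ Γ₀⊆Δ Ha k →
        ⇒E (⇒E (provable10 Γ₀⊆Δ r b∈ θ) (hyp k))
          -- The context now starts with the pair of the head and `b`, followed by `b?`; the history
          -- of the head is carried over to `b`.
          (⇒I (⇒I (after-step H (there ∘ there ∘ Γ₀⊆Δ) (All.map (there ∘ there) Ha) (here refl)
            λ Δ′ ⊆Δ′ Hb → refutes Δ′ (⊆Δ′ ∘ there ∘ there ∘ Γ₀⊆Δ) (⊆Δ′ (here refl) ∷ Hb)
                                  (⊆Δ′ (there (here refl))))))
      ... | inj₁ is with All.decide (λ b → Sum.swap (toSum (T? (M (ground P θ b))))) negative
      ...   | inj₂ some = let b , b∈ , b∈M = find some in inj₂ λ Δ Γ₀⊆Δ _ k →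
        ⇒E (⇒E (provable11 Γ₀⊆Δ r b∈ θ) (hyp k)) (hyp (Γ₀⊆Δ (pos∈ b∈M)))
      ...   | inj₁ ns = inj₁ (derive (reduct r θ (Allₚ.map⁺ ns)) (Allₚ.map⁺ is))

      module _ (z : Vec Const (arity R))
               (decide-body : ∀ b → I P M b ⊎ Refutes (R ⟨ z ⟩ ∷ H) b) where

        decide-matched : ∀ θ → (∀ p → lookup z p ≡ groundTerm P θ (lookup u p)) →
                         ∀ ν → I P M (R ⟨ z ⟩) ⊎ Unsupported ny ≤-refl z ν
        decide-matched θ agree ν = transport z≡ ν≡ (decide-instance θν) decide-body
          where
          θν : Fin (nx + ny) → Const
          θν = [ θ , lookup ν ]′ ∘ splitAt nx
          z≡ : args (head r θν) ≡ z
          z≡ = lookup-ext λ p → trans (lookup-head r θν p) (trans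
            (groundTerm-cong (λ i → cong [ θ , lookup ν ]′ (splitAt-↑ˡ nx i ny)) (lookup u p))
            (sym (agree p)))
          ν≡ : yᵍ r θν ≡ ν
          ν≡ = trans (tabulate-cong λ j → cong [ θ , lookup ν ]′ (splitAt-↑ʳ nx ny j))
                     (tabulate∘lookup ν)
          transport : ∀ {z′ ν′} → z′ ≡ z → ν′ ≡ ν →
            ((∀ b → I P M b ⊎ Refutes (R ⟨ z′ ⟩ ∷ H) b) →
             I P M (R ⟨ z′ ⟩) ⊎ Unsupported ny ≤-refl z′ ν′) →
            (∀ b → I P M b ⊎ Refutes (R ⟨ z ⟩ ∷ H) b) → I P M (R ⟨ z ⟩) ⊎ Unsupported ny ≤-refl z ν
          transport refl refl f = f

        -- One constant leading to a derivation of the head settles the matter; otherwise the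
        -- refutations for all constants are the premises of (9).
        decide-y : ∀ i → (∀ ν → I P M (R ⟨ z ⟩) ⊎ Unsupported (suc (toℕ i)) (toℕ<n i) z ν) →
                   ∀ ν → I P M (R ⟨ z ⟩) ⊎ Unsupported (toℕ i) (<⇒≤ (toℕ<n i)) z ν
        decide-y i rest ν with decide-Fin (λ c → Sum.swap (rest (ν ∷ʳ c)))
        ... | inj₂ i∈ = inj₁ i∈
        ... | inj₁ fs = inj₂ λ Δ Γ₀⊆Δ Ha k →
          ⇒*E (⇒E (provable9 Γ₀⊆Δ r i z ν) (hyp k)) (Allₚ.map⁺ (All.universal
            (λ c → ⇒I (fs c _ (there ∘ Γ₀⊆Δ) (All.map there Ha) (here refl))) (allFin #const)))

        decide-rule : I P M (R ⟨ z ⟩) ⊎ (∀ Δ → Γ₀ ⊆ Δ → After H (R ⟨ z ⟩) Δ → Δ ⊢ reject r z)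
        decide-rule with match r z
        ... | inj₂ rejects     = inj₂ λ Δ Γ₀⊆Δ _ → rejects Δ Γ₀⊆Δ
        ... | inj₁ (θ , agree) = Sum.map₂
          (λ f Δ Γ₀⊆Δ Ha → ⇒I (f _ (there ∘ Γ₀⊆Δ) (All.map there Ha) (here refl)))
          (downward (λ m m≤ → ∀ ν → I P M (R ⟨ z ⟩) ⊎ Unsupported m m≤ z ν)
                    decide-y (decide-matched θ agree) [])

    -- H is the loop-checking history of a branch and U the list of unvisited atoms:
    -- a repeated atom is refuted by (13), so a branch visits every atom at most once.
    search : ∀ n {U} H → length U ≡ n → (∀ b → b ∈ H ⊎ b ∈ U) → ∀ a → I P M a ⊎ Refutes H a
    search n H len cover a with cover a
    search n H len cover a | inj₁ a∈H =
      inj₂ λ Δ Γ₀⊆Δ Ha _ → ⇒E (provable13 Γ₀⊆Δ a) (hyp (All.lookup Ha a∈H))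
    search zero    {[]} H len cover a | inj₂ ()
    search (suc n) H len cover (R ⟨ z ⟩) | inj₂ a∈U =
      let U′ , len′ , split = remove a∈U
          rest = search n (R ⟨ z ⟩ ∷ H) (suc-injective (trans (sym len′) len))
                   λ b → [ inj₁ ∘ there , Sum.map₁ here ∘ split ]′ (cover b)
      in [ inj₂ ∘ refutes , inj₁ ]′
           (decide-all (λ r → Sum.swap (decide-rule r H z rest)) (allFin _))
      where
      refutes : All (λ r → ∀ Δ → Γ₀ ⊆ Δ → After H (R ⟨ z ⟩) Δ → Δ ⊢ reject r z) (allFin _) →
                Refutes H (R ⟨ z ⟩)
      refutes rejects Δ Γ₀⊆Δ Ha q =
        ⇒*E (⇒E (provable6 Γ₀⊆Δ (R ⟨ z ⟩)) (hyp q))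
          (Allₚ.map⁺ (All.map (λ f → f Δ Γ₀⊆Δ Ha) rejects))

    -- Recursion on the derivation with axiom (5): positive premises come from the subderivations,
    -- negative ones from the literals of `M` in `Γ₀`.
    bang⇒• : ∀ {a} → I P M a → ∀ Δ → Γ₀ ⊆ Δ → bangᵃ a ∈ Δ → Δ ⊢ prop •′
    bang⇒•* : ∀ {as} → All (I P M) as → ∀ Δ → Γ₀ ⊆ Δ → All (λ b → Δ ⊢ bangᵃ b ⇒ prop •′) as
    bang⇒• (derive (reduct r θ ns) is) Δ Γ₀⊆Δ a! =
      ⇒*E (⇒*E (⇒E (provable5 Γ₀⊆Δ r θ) (hyp a!)) (Allₚ.map⁺ (Allₚ.map⁻ (bang⇒•* is Δ Γ₀⊆Δ))))
        (Allₚ.map⁺ (All.map (λ b∉M → hyp (Γ₀⊆Δ (bar∈ b∉M))) (Allₚ.map⁻ ns)))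
    bang⇒•* []       Δ Γ₀⊆Δ = []
    bang⇒•* (i ∷ is) Δ Γ₀⊆Δ = ⇒I (bang⇒• i _ (there ∘ Γ₀⊆Δ) (here refl)) ∷ bang⇒•* is Δ Γ₀⊆Δ

    Loop : Set
    Loop = Γ₀ ⊢ prop loop

    -- The search starts with empty history. For `a` in `M`, a refutation from `a?` gives `B` by
    -- (4), and then `loop` by (2).
    derived-or-loop : ∀ a → (T (M a) → I P M a) ⊎ Loop
    derived-or-loop a with T? (M a) | search _ [] refl (inj₂ ∘ ∈-atoms) a
    ... | no a∉M  | _       = inj₁ λ a∈M → contradiction a∈M a∉M
    ... | yes _   | inj₁ i  = inj₁ λ _ → i
    ... | yes a∈M | inj₂ f  = inj₂ (⇒E (B⇒loop id)
      (⇒E (⇒E (provable4 id a) (hyp (pos∈ a∈M))) (⇒I (f _ there [] (here refl)))))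

    Closed : ∀ {R} (r : Rule R) → let open Clause (rule r) in (Fin (nx + ny) → Const) → Set
    Closed r θ = All (λ b → T (M (ground P θ b))) positive →
                 All (λ b → ¬ T (M (ground P θ b))) negative → T (M (head r θ))
      where open Clause (rule r)

    -- Valuations will be enumerated as vectors, so a given one is only pointwise equal to a listed
    -- one.
    Closed-cong : ∀ {R} (r : Rule R) {θ τ} → θ ≗ τ → Closed r θ → Closed r τ
    Closed-cong r eq closed ps ns =
      subst (T ∘ M) (ground-cong eq _)
        (closed (All.map (λ {b} → subst (T ∘ M) (sym (ground-cong eq b))) ps)
                (All.map (λ {b} → subst (λ b → ¬ T (M b)) (sym (ground-cong eq b))) ns))

    -- If `M` violates the instance, the positive body atoms lie in `M`, hence in `I P M`, and the
    -- head is derived although it is outside `M`. Then `bang⇒•` and (3) give `A`.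
    closed-or-loop : (∀ a → T (M a) → I P M a) → ∀ {R} (r : Rule R) θ → Closed r θ ⊎ Loop
    closed-or-loop M⊆I r θ
      with T? (M (head r θ))
         | All.all? (λ b → T? (M (ground P θ b))) (Clause.positive (rule r))
         | All.all? (λ b → ¬? (T? (M (ground P θ b)))) (Clause.negative (rule r))
    ... | yes h∈M | _      | _      = inj₁ λ _ _ → h∈M
    ... | no _    | no ¬ps | _      = inj₁ λ ps _ → contradiction ps ¬ps
    ... | no _    | yes _  | no ¬ns = inj₁ λ _ ns → contradiction ns ¬ns
    ... | no h∉M  | yes ps | yes ns = inj₂ (⇒E (A⇒loop id)
      (⇒E (⇒E (provable3 id (head r θ)) (hyp (bar∈ h∉M)))
        (⇒I (bang⇒• (derive (reduct r θ (Allₚ.map⁺ ns)) (Allₚ.map⁺ (All.map (M⊆I _) ps)))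
                    _ there (here refl)))))

    AllClosed : Set
    AllClosed = ∀ R (r : Rule R) θ → Closed r θ

    -- Minimality of the least fixed point, by induction on derivations.
    I⊆closed : AllClosed → ∀ {a} → I P M a → T (M a)
    I⊆closed* : AllClosed → ∀ {as} → All (I P M) as → All (T ∘ M) as
    I⊆closed closed (derive (reduct r θ ns) is) =
      closed _ r θ (Allₚ.map⁻ (I⊆closed* closed is)) (Allₚ.map⁻ ns)
    I⊆closed* closed []       = []
    I⊆closed* closed (i ∷ is) = I⊆closed closed i ∷ I⊆closed* closed is

    all-closed-or-loop : (∀ a → T (M a) → I P M a) → AllClosed ⊎ Loop
    all-closed-or-loop M⊆I = Sum.map₁
      (λ closed R r θ → Closed-cong r (lookup∘tabulate θ)
        (All.lookup (closed R r) (∈-allVec (tabulate θ))))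
      (decide-Fin λ R → decide-Fin λ r →
        decide-all (λ v → closed-or-loop M⊆I {R} r (lookup v)) (allVec _))

    stable-or-loop : Stable P M ⊎ Loop
    stable-or-loop with decide-all derived-or-loop atoms
    ... | inj₂ d  = inj₂ d
    ... | inj₁ ds = Sum.map₁ (λ closed a → mk⇔ (M⊆I a) (I⊆closed closed)) (all-closed-or-loop M⊆I)
      where
      M⊆I : ∀ a → T (M a) → I P M a
      M⊆I a = All.lookup ds (∈-atoms a)

    entailed⇒loop : Entails P Ω → Loop
    entailed⇒loop entails with stable-or-loop
    ... | inj₁ stable = ⇒E (Ω⇒loop id) (hyp (pos∈ (entails M stable)))
    ... | inj₂ d      = d

-- Splitting on all ground atoms, and the equivalence

module _ (P : Program) (Ω : GroundAtom P) where
  open Program P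
  open Encoding P hiding (φ)
  open Ground P
  open Derivations P Ω
  open Search P Ω using (entailed⇒loop)

  -- Uses axiom (1) for each atom in turn; the continuation is run on every branch, where a literal
  -- has been chosen for each listed atom.
  case-split : ∀ {Γ} as → axioms Ω ⊆ Γ →
               (∀ Δ → Γ ⊆ Δ → All (λ a → ∃ λ b → literal a b ∈ Δ) as → Δ ⊢ prop loop) →
               Γ ⊢ prop loop
  case-split []       ax k = k _ id []
  case-split (a ∷ as) ax k = ⇒E (⇒E (Axioms.provable1 ax a) (branch true)) (branch false)
    where
    branch : ∀ b → _ ⊢ literal a b ⇒ prop loop
    branch b = ⇒I (case-split as (there ∘ ax) λ Δ ⊆Δ lits →
      k Δ (⊆Δ ∘ there) ((b , ⊆Δ (here refl)) ∷ lits))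

  entailed⇒provable : Entails P Ω → [] ⊢ φ P Ω
  entailed⇒provable entails = ⇒*I (axioms Ω) λ Γ _ ax∈Γ →
    case-split atoms (All.lookup ax∈Γ) λ Δ Γ⊆Δ lits →
      -- The branch determines the model: `M` takes the value chosen at the entry where `∈-atoms a`
      -- finds `a`, and the same entry shows that the matching literal is in `Δ`.
      let M = λ a → proj₁ (All.lookup lits (∈-atoms a)) in
      entailed⇒loop M Δ (Γ⊆Δ ∘ All.lookup ax∈Γ) (λ a → proj₂ (All.lookup lits (∈-atoms a))) entails

proposition1 : (P : Program) (Ω : GroundAtom P) → ([] ⊢ φ P Ω) ⇔ Entails P Ω
proposition1 P Ω = mk⇔
  (λ d M stable → Countermodel.provable⇒member P M stable Ω d)
  (entailed⇒provable P Ω)
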